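{- Let $n,w,d\ge1$, $N=2^n$, and let $\mathbb{F}$ be a field with $|\mathbb{F}|>nd$. Let $F\in\mathbb{F}[X_1,\ldots,X_N]$ have individual degree at most $d$ and be computed by a commutative roABP of width $w$. Then $F\not\equiv0$ if and only if $F\circ\mathcal{G}^{\mathrm{SSV}}_{n,1+4\log w}\not\equiv0$.
   Context: Let $P(z_1,\ldots,z_n,x_1,\ldots,x_n)=\prod_{i=1}^n(z_ix_i+(1-z_i))$ and $Q^{\mathrm{SSV}}_{n,k}(y,z,x)=\sum_{j=1}^k y_jP(z_j,x)$ with $z_j=(z_{j,1},\ldots,z_{j,n})$; $\mathcal{G}^{\mathrm{SSV}}_{n,k}(y,z)$ is the coefficient vector of $Q^{\mathrm{SSV}}_{n,k}$ as a multilinear polynomial in $x$, with coordinates indexed by subsets $S\subseteq[n]$ and identified with $X_1,\ldots,X_N$ via $i-1=\sum_{k\in S}2^{k-1}$; $F\circ\mathcal{G}$ denotes substituting coordinate $i$ for $X_i$. A read-once oblivious algebraic branching program (roABP) of width $w$ in variable order $\sigma$ (a permutation of $[N]$) computes $F=\big(\prod_{i=1}^N M_i(X_{\sigma(i)})\big)_{1,1}$ where each $M_i$ is a $w\times w$ matrix whose entries are univariate polynomials in $X_{\sigma(i)}$. $F$ is computed by a width-$w$ commutative roABP if it is computed by a width-$w$ roABP in every variable order. Here $\log$ is base $2$ (taken so that $1+4\log w$ is an integer). -}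

module Defs where

import Data.Nat.Properties as ℕ
open import Algebra.Apartness.Bundles using (HeytingField; HeytingCommutativeRing)
open import Algebra.Bundles using (CommutativeRing)
open import Algebra.Bundles.Raw using (RawRing)
import Algebra.Definitions.RawSemiring as RawSemiringDefs
open import Algebra.Properties.Semiring.Sum ℕ.+-*-semiring using (sum-cong-≗; *-distribˡ-sum) renaming (sum to sumℕ)
open import Data.Bool.Base using (Bool; true; false; if_then_else_)
open import Data.Fin.Base using (Fin; toℕ; fromℕ<; _↑ˡ_; _↑ʳ_; combine)
import Data.Fin.Properties as Fin
open import Data.Fin.Permutation using (Permutation′; _⟨$⟩ʳ_)
open import Data.Fin.Subset using (Subset)
open import Data.List.Base as List using (List; []; _∷_)
open import Data.Nat.Base as ℕ using (ℕ; zero; suc; NonZero)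
open import Data.Nat.DivMod using (_/_; _%_; m%n<n; m≡m%n+[m/n]*n; m<n*o⇒m/o<n)
open import Data.Product.Base using (∃-syntax; _×_; _,_; map₁)
open import Data.Vec.Base as Vec using (Vec; []; _∷_; lookup; zipWith; replicate; _[_]≔_)
import Data.Vec.Properties as Vec
open import Data.Vec.Functional as Vector using (Vector)
open import Function.Bundles using (Injection)
open import Level using (Level; _⊔_)
open import Relation.Binary.PropositionalEquality using (_≡_; refl; sym; trans; cong; cong₂; subst; setoid; module ≡-Reasoning)
open import Relation.Nullary.Decidable.Core using (does)
open import Relation.Nullary.Negation.Core using (¬_; contradiction)

private
  variable
    c ℓ ℓ₁ ℓ₂ : Level

-- Classically a Heyting field is exactly a field: apartness from 0# is
-- invertibility, tightness makes every x ≉ 0# invertible, and 0# ≉ 1# holds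
-- since 1# is invertible.

fieldCommutativeRing : HeytingField c ℓ₁ ℓ₂ → CommutativeRing c ℓ₁
fieldCommutativeRing 𝔽 =
  HeytingCommutativeRing.commutativeRing (HeytingField.heytingCommutativeRing 𝔽)

fieldRing : HeytingField c ℓ₁ ℓ₂ → RawRing c ℓ₁
fieldRing 𝔽 = CommutativeRing.rawRing (fieldCommutativeRing 𝔽)

-- |𝔽| > m: there are m + 1 pairwise distinct elements.
Cardinality> : HeytingField c ℓ₁ ℓ₂ → ℕ → Set (c ⊔ ℓ₁)
Cardinality> 𝔽 m =
  Injection (setoid (Fin (suc m))) (CommutativeRing.setoid (fieldCommutativeRing 𝔽))

-- Formal polynomials over R in m variables: a polynomial is a list of terms
-- (coefficient , exponent vector), in which an exponent vector may occur
-- several times. Two polynomials are equal when all their coefficients are.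

module Polynomial (R : RawRing c ℓ) (m : ℕ) where

  private
    module R = RawRing R

  Exponent : Set
  Exponent = Vec ℕ m

  Poly : Set c
  Poly = List (R.Carrier × Exponent)

  coeff : Poly → Exponent → R.Carrier
  coeff []             e = R.0#
  coeff ((a , e′) ∷ p) e =
    if does (Vec.≡-dec ℕ._≟_ e′ e) then a R.+ coeff p e else coeff p e

  _≈ₚ_ : Poly → Poly → Set ℓ
  p ≈ₚ q = ∀ e → coeff p e R.≈ coeff q e

  con : R.Carrier → Poly
  con a = (a , replicate m 0) ∷ []

  var : Fin m → Poly
  var i = (R.1# , replicate m 0 [ i ]≔ 1) ∷ []

  _*ₚ_ : Poly → Poly → Poly
  _*ₚ_ = List.cartesianProductWith
    λ (a , e) (b , f) → (a R.* b) , zipWith ℕ._+_ e f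

  polyRing : RawRing c ℓ
  polyRing = record
    { Carrier = Poly
    ; _≈_     = _≈ₚ_
    ; _+_     = List._++_
    ; _*_     = _*ₚ_
    ; -_      = List.map (map₁ R.-_)
    ; 0#      = []
    ; 1#      = con R.1#
    }

  Nonzero : Poly → Set ℓ
  Nonzero p = ¬ (p ≈ₚ RawRing.0# polyRing)

  IndividualDegree≤ : ℕ → Poly → Set ℓ
  IndividualDegree≤ d p = ∀ e i → d ℕ.< lookup e i → coeff p e R.≈ R.0#

open Polynomial public using (Poly; polyRing)

compose : (R : RawRing c ℓ) {m m′ : ℕ} → Poly R m → (Fin m → Poly R m′) → Poly R m′
compose R {m} {m′} p g = List.foldr (λ (a , e) q → term a e + q) 0# p
  where
  open RawRing (polyRing R m′)
  open RawSemiringDefs rawSemiring using (product; _^_)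

  term : RawRing.Carrier R → Vec ℕ m → Poly R m′
  term a e = Polynomial.con R m′ a * product (λ i → g i ^ lookup e i)

module Matrices (R : RawRing c ℓ) (w : ℕ) where

  open RawRing R
  open RawSemiringDefs rawSemiring using (sum)

  Matrix : Set c
  Matrix = Fin w → Fin w → Carrier

  identity : Matrix
  identity i j = if does (i Fin.≟ j) then 1# else 0#

  _⊗_ : Matrix → Matrix → Matrix
  (A ⊗ B) i j = sum λ l → A i l * B l j

  -- M₁ ⊗ M₂ ⊗ ⋯ ⊗ M_N, in this order
  matrixProduct : ∀ {N} → Vector Matrix N → Matrix
  matrixProduct = Vector.foldr _⊗_ identity

module ROABP (R : RawRing c ℓ) (w : ℕ) .{{_ : NonZero w}} {N : ℕ} where

  open Matrices (polyRing R N) w using (matrixProduct)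

  first : Fin w
  first = fromℕ< (ℕ.>-nonZero⁻¹ w)

  UnivariateMatrices : Set c
  UnivariateMatrices = Fin N → Fin w → Fin w → Poly R 1

  roABP : Permutation′ N → UnivariateMatrices → Poly R N
  roABP σ M = matrixProduct layer first first
    where
    layer : Fin N → Fin w → Fin w → Poly R N
    layer i a b = compose R (M i a b) (λ _ → Polynomial.var R N (σ ⟨$⟩ʳ i))

  ComputedByROABP : Permutation′ N → Poly R N → Set (c ⊔ ℓ)
  ComputedByROABP σ F = ∃[ M ] RawRing._≈_ (polyRing R N) F (roABP σ M)

  ComputedByCommutativeROABP : Poly R N → Set (c ⊔ ℓ)
  ComputedByCommutativeROABP F = ∀ σ → ComputedByROABP σ F

open ROABP public using (ComputedByCommutativeROABP)

-- Indices are 0-based: position k of a subset of [ n ] stands for the element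
-- k + 1, and i : Fin (2 ^ n) for the variable X_{i + 1}. So the subset S
-- attached to i is the one with i ≡ Σ_{k ∈ S} 2 ^ k; see subsetAt-index.

bit : Bool → ℕ
bit b = if b then 1 else 0

bits : ∀ n → ℕ → Subset n
bits zero    i = []
bits (suc n) i = (i % 2 ℕ.≡ᵇ 1) ∷ bits n (i / 2)

subsetAt : ∀ n → Fin (2 ℕ.^ n) → Subset n
subsetAt n i = bits n (toℕ i)

index : ∀ {n} → Subset n → ℕ
index S = sumℕ λ k → if lookup S k then 2 ℕ.^ toℕ k else 0

private
  index-∷ : ∀ {n} b (S : Subset n) → index (b ∷ S) ≡ bit b ℕ.+ 2 ℕ.* index S
  index-∷ b S = cong (bit b ℕ.+_)
    (trans (sum-cong-≗ double) (sym (*-distribˡ-sum 2 (λ k → if lookup S k then 2 ℕ.^ toℕ k else 0))))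
    where
    double : ∀ k → (if lookup S k then 2 ℕ.^ suc (toℕ k) else 0)
                 ≡ 2 ℕ.* (if lookup S k then 2 ℕ.^ toℕ k else 0)
    double k with lookup S k
    ... | true  = refl
    ... | false = refl

  bit-mod₂ : ∀ r → r ℕ.< 2 → bit (r ℕ.≡ᵇ 1) ≡ r
  bit-mod₂ 0             _   = refl
  bit-mod₂ 1             _   = refl
  bit-mod₂ (suc (suc _)) r<2 = contradiction r<2 λ { (ℕ.s≤s (ℕ.s≤s ())) }

  index-bits : ∀ n i → i ℕ.< 2 ℕ.^ n → index (bits n i) ≡ i
  index-bits zero    i i<1 = sym (ℕ.n<1⇒n≡0 i<1)
  index-bits (suc n) i i<N = begin
    index (bits (suc n) i)                              ≡⟨ index-∷ (i % 2 ℕ.≡ᵇ 1) (bits n (i / 2)) ⟩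
    bit (i % 2 ℕ.≡ᵇ 1) ℕ.+ 2 ℕ.* index (bits n (i / 2)) ≡⟨ cong₂ (λ a b → a ℕ.+ 2 ℕ.* b) (bit-mod₂ (i % 2) (m%n<n i 2)) (index-bits n (i / 2) i/2<) ⟩
    i % 2 ℕ.+ 2 ℕ.* (i / 2)                             ≡⟨ cong (i % 2 ℕ.+_) (ℕ.*-comm 2 (i / 2)) ⟩
    i % 2 ℕ.+ i / 2 ℕ.* 2                               ≡⟨ m≡m%n+[m/n]*n i 2 ⟨
    i                                                   ∎
    where
    open ≡-Reasoning
    i/2< : i / 2 ℕ.< 2 ℕ.^ n
    i/2< = m<n*o⇒m/o<n (subst (i ℕ.<_) (ℕ.*-comm 2 (2 ℕ.^ n)) i<N)

subsetAt-index : ∀ n (i : Fin (2 ℕ.^ n)) → index (subsetAt n i) ≡ toℕ i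
subsetAt-index n i = index-bits n (toℕ i) (Fin.toℕ<n i)

-- Q is formed in R[y,z][x], so that its coefficient vector in x has entries in
-- R[y,z]. The k + k * n variables of R[y,z] are y_1, …, y_k followed by the
-- z_{j,i} in row-major order.

module SSV (R : RawRing c ℓ) (n k : ℕ) where

  #yz : ℕ
  #yz = k ℕ.+ k ℕ.* n

  R[y,z] : RawRing c ℓ
  R[y,z] = polyRing R #yz

  R[y,z][x] : RawRing c ℓ
  R[y,z][x] = polyRing R[y,z] n

  y : Fin k → Poly R #yz
  y j = Polynomial.var R #yz (j ↑ˡ (k ℕ.* n))

  z : Fin k → Fin n → Poly R #yz
  z j i = Polynomial.var R #yz (k ↑ʳ combine j i)

  open Polynomial R[y,z] n using (con; var; coeff)
  open RawRing R[y,z] using (1#) renaming (_+_ to _+ᶜ_; -_ to -ᶜ_)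
  open RawRing R[y,z][x] using (_+_; _*_; rawSemiring)
  open RawSemiringDefs rawSemiring using (product) renaming (sum to ∑)

  P : (Fin n → Poly R #yz) → Poly R[y,z] n
  P ζ = product λ i → con (ζ i) * var i + con (1# +ᶜ (-ᶜ ζ i))

  Q : Poly R[y,z] n
  Q = ∑ λ j → con (y j) * P (z j)

  𝒢 : Fin (2 ℕ.^ n) → Poly R #yz
  𝒢 i = coeff Q (Vec.map bit (subsetAt n i))

{-# OPTIONS --safe #-}
-- Write m = 1 + ⌈log₂ w⌉, so w < 2 ^ m, and let c = Σ_{j ≤ m} y_j P(z_j). If F ∘ 𝒢 = 0, then F vanishes at c + x for
-- every x supported on fewer than m coordinates, since setting z_j to the indicator of S turns y_j P(z_j) into y_j e_S.
-- The support bound s of x is raised one step at a time; once s = N, taking y = 0 gives F = 0.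
--
-- For the step, let x be supported on s + 1 ≥ m coordinates and let B be m of them. A width w program reading B first
-- gives F = Σ_{l ≤ w} g_l(X_B) h_l(X_rest). Hence v(U) = Σ_l h_l(c + x) g_l(U) vanishes whenever U_i = c_i for some i in
-- B. With z_j = indicator of B_j + t ζ_j we have c_i = y_i + O(t), so the lowest coefficient of v in t vanishes on every
-- diagonal U_i = y_i. A nonzero polynomial in U and y with this property has tensor rank at least 2 ^ m in (U | y): its
-- coefficient matrix contains a triangular 2 ^ m × 2 ^ m submatrix. As the rank is at most w, v = 0.

module Submission where

open import Defs
open import Algebra.Apartness.Bundles using (HeytingField)
open import Algebra.Bundles using (CommutativeRing)
open import Algebra.Bundles.Raw using (RawRing)
import Algebra.Definitions.RawSemiring as RawSemiringDefs
open import Algebra.Structures using (IsCommutativeRing)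
open import Data.Bool.Base using (Bool; true; false; if_then_else_)
import Data.Bool.Properties as Bool
open import Data.Empty using (⊥)
open import Data.Fin.Base using (Fin; zero; suc; toℕ; fromℕ<; inject≤; punchIn; _↑ˡ_; _↑ʳ_; combine; remQuot; splitAt)
open import Data.Fin.Permutation as Perm using (Permutation′; _⟨$⟩ʳ_; _⟨$⟩ˡ_; _∘ₚ_; transpose; inverseˡ; inverseʳ)
import Data.Fin.Properties as Fin
open import Data.List.Base as List using (List; []; _∷_; _++_; length)
import Data.List.Properties as List
open import Data.List.Relation.Unary.All as All using (All; []; _∷_)
import Data.List.Relation.Unary.All.Properties as All
open import Data.Nat.Base as ℕ using (ℕ; zero; suc; _∸_; NonZero)
open import Data.Nat.Induction using (<-rec)
open import Data.Nat.Logarithm using (⌈log₂_⌉; ⌈log₂⌉-mono-≤; ⌈log₂⌈n/2⌉⌉≡⌈log₂n⌉∸1; ⌈log₂2^n⌉≡n)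
import Data.Nat.Properties as ℕ
open import Data.Product.Base using (∃-syntax; _×_; _,_; proj₁; proj₂; map₁; map₂; uncurry) renaming (map to map×)
open import Data.Sum.Base using (inj₁; inj₂)
open import Data.Unit.Polymorphic.Base using (⊤; tt)
open import Data.Vec.Base as Vec using (Vec; []; _∷_; lookup; zipWith; replicate)
open import Data.Vec.Functional using () renaming (_∷_ to _◂_; _++_ to _++ᶠ_)
open import Data.Vec.Functional.Properties using (lookup-++ˡ; lookup-++ʳ)
import Data.Vec.Properties as Vec
open import Function.Base using (_∘_; id)
open import Function.Bundles using (Injection; _⇔_; mk⇔)
open import Function.Properties.Inverse using (Inverse⇒Injection)
open import Level using (Level; _⊔_) renaming (suc to lsuc)
open import Relation.Binary.Definitions using (tri<; tri≈; tri>)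
open import Relation.Binary.PropositionalEquality as ≡ using (_≡_; _≢_)
import Relation.Binary.Reasoning.Setoid
open import Relation.Nullary.Decidable using (yes; no; does; dec-true; dec-false)
open import Relation.Nullary.Negation.Core using (¬_; contradiction)

-- Every vanishing statement below is about values at points of all commutative `K`-algebras `B`.
-- Values in `K` alone would not determine a polynomial when `K` is finite, whereas a generic point,
-- with `B` a polynomial ring, gives back the polynomial itself. Each substitution of the argument
-- is then an instantiation of a hypothesis, and coefficients are read off by adjoining one more
-- variable to `B`. The scale t is there because c_i mixes all the y_j and z_j, while the rank bound
-- is about diagonals U_i = Y_i with independent Y_i. The lowest order in t restores this
-- independence; once v is zero to every order, t is set to 1. The exponent m is one more than the
-- rounded logarithm because 2 ^ m has to exceed the rank bound w strictly. Being zero is not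
-- decidable in a Heyting field, so the lowest nonzero coefficient or antidiagonal cannot be
-- searched for. Strong induction replaces the search, and triangular submatrices exist only up to
-- double negation. This suffices because the goals are equations, and equality is the negation of
-- apartness.

private
  variable
    c ℓ ℓ₁ ℓ₂ : Level

-- Commutative rings and their homomorphisms

module Ring (A : CommutativeRing c ℓ) where
  open CommutativeRing A public hiding (_-_; zero)
  open RawSemiringDefs (RawRing.rawSemiring rawRing) public using (product; _^_)
  open import Algebra.Properties.Semiring.Sum semiring public
    using (sum; sum-cong-≋; sum-remove; sum-replicate-zero; ∑-distrib-+; ∑-comm; *-distribˡ-sum; *-distribʳ-sum)
  open import Algebra.Properties.CommutativeMonoid.Sum *-commutativeMonoid public
    using () renaming (sum-cong-≋ to product-cong; ∑-distrib-+ to product-distrib-*; sum-replicate-zero to product-replicate-one)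
  open import Algebra.Properties.Semiring.Exp semiring public using (^-homo-*; ^-congˡ)
  open import Algebra.Properties.Ring ring public using (-0#≈0#; -‿distribˡ-*; -‿distribʳ-*; -‿+-comm; +-cancelˡ)
  module ≈-Reasoning = Relation.Binary.Reasoning.Setoid setoid

  sum-zero : ∀ {n} (f : Fin n → Carrier) → (∀ i → f i ≈ 0#) → sum f ≈ 0#
  sum-zero {n} f f≈0 = trans (sum-cong-≋ f≈0) (sum-replicate-zero n)

  medial : ∀ x y u v → (x + y) + (u + v) ≈ (x + u) + (y + v)
  medial x y u v = begin
    (x + y) + (u + v) ≈⟨ +-assoc x y (u + v) ⟩
    x + (y + (u + v)) ≈⟨ +-congˡ (sym (+-assoc y u v)) ⟩
    x + ((y + u) + v) ≈⟨ +-congˡ (+-congʳ (+-comm y u)) ⟩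
    x + ((u + y) + v) ≈⟨ +-congˡ (+-assoc u y v) ⟩
    x + (u + (y + v)) ≈⟨ +-assoc x u (y + v) ⟨
    (x + u) + (y + v) ∎
    where open ≈-Reasoning

-- A `Hom K B` is how `B` is given the structure of a `K`-algebra in the vanishing statements below.
record Hom (A B : CommutativeRing c ℓ) : Set (c ⊔ ℓ) where
  private
    module A = Ring A
    module B = Ring B
  field
    ⟦_⟧    : A.Carrier → B.Carrier
    ⟦⟧-cong : ∀ {x y} → x A.≈ y → ⟦ x ⟧ B.≈ ⟦ y ⟧
    +-homo : ∀ x y → ⟦ x A.+ y ⟧ B.≈ ⟦ x ⟧ B.+ ⟦ y ⟧
    *-homo : ∀ x y → ⟦ x A.* y ⟧ B.≈ ⟦ x ⟧ B.* ⟦ y ⟧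
    0-homo : ⟦ A.0# ⟧ B.≈ B.0#
    1-homo : ⟦ A.1# ⟧ B.≈ B.1#

  -‿homo : ∀ x → ⟦ A.- x ⟧ B.≈ B.- ⟦ x ⟧
  -‿homo x = B.+-cancelˡ ⟦ x ⟧ _ _ (begin
    ⟦ x ⟧ B.+ ⟦ A.- x ⟧   ≈⟨ +-homo x (A.- x) ⟨
    ⟦ x A.+ (A.- x) ⟧     ≈⟨ ⟦⟧-cong (A.-‿inverseʳ x) ⟩
    ⟦ A.0# ⟧              ≈⟨ 0-homo ⟩
    B.0#                  ≈⟨ B.-‿inverseʳ ⟦ x ⟧ ⟨
    ⟦ x ⟧ B.+ (B.- ⟦ x ⟧) ∎)
    where open B.≈-Reasoning

  sum-homo : ∀ {n} (f : Fin n → A.Carrier) → ⟦ A.sum f ⟧ B.≈ B.sum (⟦_⟧ ∘ f)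
  sum-homo {zero}  f = 0-homo
  sum-homo {suc n} f = B.trans (+-homo _ _) (B.+-congˡ (sum-homo (f ∘ suc)))

  product-homo : ∀ {n} (f : Fin n → A.Carrier) → ⟦ A.product f ⟧ B.≈ B.product (⟦_⟧ ∘ f)
  product-homo {zero}  f = 1-homo
  product-homo {suc n} f = B.trans (*-homo _ _) (B.*-congˡ (product-homo (f ∘ suc)))

  ^-homo : ∀ x n → ⟦ x A.^ n ⟧ B.≈ ⟦ x ⟧ B.^ n
  ^-homo x zero    = 1-homo
  ^-homo x (suc n) = B.trans (*-homo _ _) (B.*-congˡ (^-homo x n))

idHom : (A : CommutativeRing c ℓ) → Hom A A
idHom A .Hom.⟦_⟧ = id
idHom A .Hom.⟦⟧-cong = id
idHom A .Hom.+-homo _ _ = CommutativeRing.refl A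
idHom A .Hom.*-homo _ _ = CommutativeRing.refl A
idHom A .Hom.0-homo = CommutativeRing.refl A
idHom A .Hom.1-homo = CommutativeRing.refl A

infixr 9 _∘ʰ_

_∘ʰ_ : {A B C : CommutativeRing c ℓ} → Hom B C → Hom A B → Hom A C
_∘ʰ_ g f .Hom.⟦_⟧ = Hom.⟦_⟧ g ∘ Hom.⟦_⟧ f
_∘ʰ_ g f .Hom.⟦⟧-cong = Hom.⟦⟧-cong g ∘ Hom.⟦⟧-cong f
_∘ʰ_ {C = C} g f .Hom.+-homo x y = CommutativeRing.trans C (Hom.⟦⟧-cong g (Hom.+-homo f x y)) (Hom.+-homo g _ _)
_∘ʰ_ {C = C} g f .Hom.*-homo x y = CommutativeRing.trans C (Hom.⟦⟧-cong g (Hom.*-homo f x y)) (Hom.*-homo g _ _)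
_∘ʰ_ {C = C} g f .Hom.0-homo = CommutativeRing.trans C (Hom.⟦⟧-cong g (Hom.0-homo f)) (Hom.0-homo g)
_∘ʰ_ {C = C} g f .Hom.1-homo = CommutativeRing.trans C (Hom.⟦⟧-cong g (Hom.1-homo f)) (Hom.1-homo g)

-- Coefficients of formal polynomials and linear functionals on exponents

infixl 6 _⊕_

_⊕_ : ∀ {m} → Vec ℕ m → Vec ℕ m → Vec ℕ m
_⊕_ = zipWith ℕ._+_

module Coeff (A : CommutativeRing c ℓ) {m : ℕ} where
  open Ring A
  open Polynomial rawRing m public using (Exponent; coeff; _≈ₚ_; _*ₚ_; con; var)

  coeff-here : ∀ a e p → coeff ((a , e) ∷ p) e ≈ a + coeff p e
  coeff-here a e p with Vec.≡-dec ℕ._≟_ e e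
  ... | yes _   = refl
  ... | no  e≢e = contradiction ≡.refl e≢e

  coeff-there : ∀ a {e′ e} p → e′ ≢ e → coeff ((a , e′) ∷ p) e ≈ coeff p e
  coeff-there a {e′} {e} p e′≢e with Vec.≡-dec ℕ._≟_ e′ e
  ... | yes e′≡e = contradiction e′≡e e′≢e
  ... | no  _    = refl

  coeff-++ : ∀ p q e → coeff (p ++ q) e ≈ coeff p e + coeff q e
  coeff-++ []             q e = sym (+-identityˡ _)
  coeff-++ ((a , e′) ∷ p) q e with Vec.≡-dec ℕ._≟_ e′ e
  ... | yes _ = trans (+-congˡ (coeff-++ p q e)) (sym (+-assoc _ _ _))
  ... | no  _ = coeff-++ p q e

  neg : Poly rawRing m → Poly rawRing m
  neg = List.map (map₁ -_)

  coeff-neg : ∀ p e → coeff (neg p) e ≈ - coeff p e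
  coeff-neg []             e = sym -0#≈0#
  coeff-neg ((a , e′) ∷ p) e with Vec.≡-dec ℕ._≟_ e′ e
  ... | yes _ = trans (+-congˡ (coeff-neg p e)) (-‿+-comm _ _)
  ... | no  _ = coeff-neg p e

-- Coefficients, products and evaluations of polynomials are all of the form Σ a · φ e over the terms (a , e), which
-- depends on the coefficients only.
module Linear {A B : CommutativeRing c ℓ} (ι : Hom A B) {m : ℕ} where
  private
    module A = Ring A
  open Ring B
  open Hom ι
  open Coeff A {m}
  open ≈-Reasoning

  lin : Poly A.rawRing m → (Exponent → Carrier) → Carrier
  lin p φ = List.foldr (λ (a , e) s → ⟦ a ⟧ * φ e + s) 0# p

  lin-congʳ : ∀ p {φ ψ} → (∀ e → φ e ≈ ψ e) → lin p φ ≈ lin p ψ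
  lin-congʳ []            φ≈ψ = refl
  lin-congʳ ((a , e) ∷ p) φ≈ψ = +-cong (*-congˡ (φ≈ψ e)) (lin-congʳ p φ≈ψ)

  lin-++ : ∀ p q φ → lin (p ++ q) φ ≈ lin p φ + lin q φ
  lin-++ []            q φ = sym (+-identityˡ _)
  lin-++ ((a , e) ∷ p) q φ = trans (+-congˡ (lin-++ p q φ)) (sym (+-assoc _ _ _))

  lin-neg : ∀ p φ → lin (neg p) φ ≈ - lin p φ
  lin-neg []            φ = sym -0#≈0#
  lin-neg ((a , e) ∷ p) φ = begin
    ⟦ A.- a ⟧ * φ e + lin (neg p) φ ≈⟨ +-cong (*-congʳ (-‿homo a)) (lin-neg p φ) ⟩
    - ⟦ a ⟧ * φ e + - lin p φ       ≈⟨ +-congʳ (-‿distribˡ-* _ _) ⟨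
    - (⟦ a ⟧ * φ e) + - lin p φ     ≈⟨ -‿+-comm _ _ ⟩
    - (⟦ a ⟧ * φ e + lin p φ)       ∎

  private
    -- Exponents may recur in a list, so the tail of a list with zero coefficients need not have
    -- zero coefficients. Removing one exponent throughout the list does keep this property.
    drop : Exponent → Poly A.rawRing m → Poly A.rawRing m
    drop e []             = []
    drop e ((a , e′) ∷ p) with Vec.≡-dec ℕ._≟_ e′ e
    ... | yes _ = drop e p
    ... | no  _ = (a , e′) ∷ drop e p

    drop-length : ∀ e p → length (drop e p) ℕ.≤ length p
    drop-length e []             = ℕ.z≤n
    drop-length e ((a , e′) ∷ p) with Vec.≡-dec ℕ._≟_ e′ e
    ... | yes _ = ℕ.m≤n⇒m≤1+n (drop-length e p)
    ... | no  _ = ℕ.s≤s (drop-length e p)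

    coeff-drop-here : ∀ e p → coeff (drop e p) e A.≈ A.0#
    coeff-drop-here e []             = A.refl
    coeff-drop-here e ((a , e′) ∷ p) with Vec.≡-dec ℕ._≟_ e′ e
    ... | yes _    = coeff-drop-here e p
    ... | no  e′≢e = A.trans (coeff-there a (drop e p) e′≢e) (coeff-drop-here e p)

    coeff-drop-there : ∀ {e e₀} p → e ≢ e₀ → coeff (drop e p) e₀ A.≈ coeff p e₀
    coeff-drop-there          []             e≢e₀ = A.refl
    coeff-drop-there {e} {e₀} ((a , e′) ∷ p) e≢e₀ with Vec.≡-dec ℕ._≟_ e′ e
    ... | yes ≡.refl = A.trans (coeff-drop-there p e≢e₀) (A.sym (coeff-there a p e≢e₀))
    ... | no  _ with Vec.≡-dec ℕ._≟_ e′ e₀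
    ...   | yes _ = A.+-congˡ (coeff-drop-there p e≢e₀)
    ...   | no  _ = coeff-drop-there p e≢e₀

    lin-drop : ∀ e p φ → lin p φ ≈ ⟦ coeff p e ⟧ * φ e + lin (drop e p) φ
    lin-drop e []             φ = sym (trans (+-identityʳ _) (trans (*-congʳ 0-homo) (zeroˡ _)))
    lin-drop e ((a , e′) ∷ p) φ with Vec.≡-dec ℕ._≟_ e′ e
    ... | yes ≡.refl = begin
      ⟦ a ⟧ * φ e + lin p φ                                       ≈⟨ +-congˡ (lin-drop e p φ) ⟩
      ⟦ a ⟧ * φ e + (⟦ coeff p e ⟧ * φ e + lin (drop e p) φ)      ≈⟨ +-assoc _ _ _ ⟨
      (⟦ a ⟧ * φ e + ⟦ coeff p e ⟧ * φ e) + lin (drop e p) φ      ≈⟨ +-congʳ (distribʳ _ _ _) ⟨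
      (⟦ a ⟧ + ⟦ coeff p e ⟧) * φ e + lin (drop e p) φ            ≈⟨ +-congʳ (*-congʳ (+-homo _ _)) ⟨
      ⟦ a A.+ coeff p e ⟧ * φ e + lin (drop e p) φ                ∎
    ... | no  _ = begin
      ⟦ a ⟧ * φ e′ + lin p φ                                      ≈⟨ +-congˡ (lin-drop e p φ) ⟩
      ⟦ a ⟧ * φ e′ + (⟦ coeff p e ⟧ * φ e + lin (drop e p) φ)     ≈⟨ +-assoc _ _ _ ⟨
      (⟦ a ⟧ * φ e′ + ⟦ coeff p e ⟧ * φ e) + lin (drop e p) φ     ≈⟨ +-congʳ (+-comm _ _) ⟩
      (⟦ coeff p e ⟧ * φ e + ⟦ a ⟧ * φ e′) + lin (drop e p) φ     ≈⟨ +-assoc _ _ _ ⟩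
      ⟦ coeff p e ⟧ * φ e + (⟦ a ⟧ * φ e′ + lin (drop e p) φ)     ∎

    -- The terms with the exponent of the head add up to its coefficient times `φ e`, which is zero.
    -- What remains is `drop e p`, shorter but not a subterm, hence the recursion on the length
    -- bound `k`.
    lin-zero′ : ∀ k p φ → length p ℕ.≤ k → (∀ e → coeff p e A.≈ A.0#) → lin p φ ≈ 0#
    lin-zero′ k       []            φ _         p≈0 = refl
    lin-zero′ (suc k) ((a , e) ∷ p) φ (ℕ.s≤s l) p≈0 = begin
      ⟦ a ⟧ * φ e + lin p φ                                  ≈⟨ +-congˡ (lin-drop e p φ) ⟩
      ⟦ a ⟧ * φ e + (⟦ coeff p e ⟧ * φ e + lin (drop e p) φ) ≈⟨ +-assoc _ _ _ ⟨
      (⟦ a ⟧ * φ e + ⟦ coeff p e ⟧ * φ e) + lin (drop e p) φ ≈⟨ +-cong (sym (distribʳ _ _ _)) rest ⟩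
      (⟦ a ⟧ + ⟦ coeff p e ⟧) * φ e + 0#                     ≈⟨ +-identityʳ _ ⟩
      (⟦ a ⟧ + ⟦ coeff p e ⟧) * φ e                          ≈⟨ *-congʳ (+-homo _ _) ⟨
      ⟦ a A.+ coeff p e ⟧ * φ e                              ≈⟨ *-congʳ (⟦⟧-cong (A.trans (A.sym (coeff-here a e p)) (p≈0 e))) ⟩
      ⟦ A.0# ⟧ * φ e                                         ≈⟨ trans (*-congʳ 0-homo) (zeroˡ _) ⟩
      0#                                                     ∎
      where
      drop≈0 : ∀ e₀ → coeff (drop e p) e₀ A.≈ A.0#
      drop≈0 e₀ with Vec.≡-dec ℕ._≟_ e e₀
      ... | yes ≡.refl = coeff-drop-here e p
      ... | no  e≢e₀   =
        A.trans (coeff-drop-there p e≢e₀) (A.trans (A.sym (coeff-there a p e≢e₀)) (p≈0 e₀))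
      rest : lin (drop e p) φ ≈ 0#
      rest = lin-zero′ k (drop e p) φ (ℕ.≤-trans (drop-length e p) l) drop≈0

  lin-zero : ∀ p φ → (∀ e → coeff p e A.≈ A.0#) → lin p φ ≈ 0#
  lin-zero p φ = lin-zero′ (length p) p φ ℕ.≤-refl

  -- Lists with equal coefficients may have unrelated shapes, so they are compared through their
  -- difference.
  lin-cong : ∀ p q φ → p ≈ₚ q → lin p φ ≈ lin q φ
  lin-cong p q φ p≈q = begin
    lin p φ                         ≈⟨ +-identityʳ _ ⟨
    lin p φ + 0#                    ≈⟨ +-congˡ (-‿inverseˡ _) ⟨
    lin p φ + (- lin q φ + lin q φ) ≈⟨ +-assoc _ _ _ ⟨
    (lin p φ + - lin q φ) + lin q φ ≈⟨ +-congʳ (+-congˡ (lin-neg q φ)) ⟨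
    (lin p φ + lin (neg q) φ) + lin q φ ≈⟨ +-congʳ (lin-++ p (neg q) φ) ⟨
    lin (p ++ neg q) φ + lin q φ    ≈⟨ +-congʳ (lin-zero (p ++ neg q) φ p-q≈0) ⟩
    0# + lin q φ                    ≈⟨ +-identityˡ _ ⟩
    lin q φ                         ∎
    where
    p-q≈0 : ∀ e → coeff (p ++ neg q) e A.≈ A.0#
    p-q≈0 e = A.trans (coeff-++ p (neg q) e)
      (A.trans (A.+-cong (p≈q e) (coeff-neg q e)) (A.-‿inverseʳ _))

  lin-0ʳ : ∀ p → lin p (λ _ → 0#) ≈ 0#
  lin-0ʳ []            = refl
  lin-0ʳ ((a , e) ∷ p) = trans (+-cong (zeroʳ _) (lin-0ʳ p)) (+-identityˡ _)

  lin-+ʳ : ∀ p φ ψ → lin p (λ e → φ e + ψ e) ≈ lin p φ + lin p ψ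
  lin-+ʳ []            φ ψ = sym (+-identityˡ _)
  lin-+ʳ ((a , e) ∷ p) φ ψ = trans (+-cong (distribˡ _ _ _) (lin-+ʳ p φ ψ)) (medial _ _ _ _)

  lin-*ʳ : ∀ p b φ → lin p (λ e → b * φ e) ≈ b * lin p φ
  lin-*ʳ []            b φ = sym (zeroʳ b)
  lin-*ʳ ((a , e) ∷ p) b φ = begin
    ⟦ a ⟧ * (b * φ e) + lin p (λ e → b * φ e) ≈⟨ +-cong x∙yz≈y∙xz (lin-*ʳ p b φ) ⟩
    b * (⟦ a ⟧ * φ e) + b * lin p φ           ≈⟨ distribˡ _ _ _ ⟨
    b * (⟦ a ⟧ * φ e + lin p φ)               ∎
    where
    x∙yz≈y∙xz : ⟦ a ⟧ * (b * φ e) ≈ b * (⟦ a ⟧ * φ e)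
    x∙yz≈y∙xz = trans (sym (*-assoc _ _ _)) (trans (*-congʳ (*-comm _ _)) (*-assoc _ _ _))

  lin-swap : ∀ p q (φ : Exponent → Exponent → Carrier) →
    lin p (λ e → lin q (λ f → φ e f)) ≈ lin q (λ f → lin p (λ e → φ e f))
  lin-swap []            q φ = sym (lin-0ʳ q)
  lin-swap ((a , e) ∷ p) q φ = begin
    ⟦ a ⟧ * lin q (φ e) + lin p (λ e → lin q (φ e))                    ≈⟨ +-cong (sym (lin-*ʳ q _ _)) (lin-swap p q φ) ⟩
    lin q (λ f → ⟦ a ⟧ * φ e f) + lin q (λ f → lin p (λ e → φ e f))    ≈⟨ lin-+ʳ q _ _ ⟨
    lin q (λ f → ⟦ a ⟧ * φ e f + lin p (λ e → φ e f))                  ∎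

  private
    lin-scale : ∀ a e q φ → lin (List.map (λ (b , f) → (a A.* b) , (e ⊕ f)) q) φ ≈ ⟦ a ⟧ * lin q (λ f → φ (e ⊕ f))
    lin-scale a e []            φ = sym (zeroʳ _)
    lin-scale a e ((b , f) ∷ q) φ = begin
      ⟦ a A.* b ⟧ * φ (e ⊕ f) + lin (List.map _ q) φ                    ≈⟨ +-cong (*-congʳ (*-homo a b)) (lin-scale a e q φ) ⟩
      (⟦ a ⟧ * ⟦ b ⟧) * φ (e ⊕ f) + ⟦ a ⟧ * lin q (λ f → φ (e ⊕ f))     ≈⟨ +-congʳ (*-assoc _ _ _) ⟩
      ⟦ a ⟧ * (⟦ b ⟧ * φ (e ⊕ f)) + ⟦ a ⟧ * lin q (λ f → φ (e ⊕ f))     ≈⟨ distribˡ _ _ _ ⟨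
      ⟦ a ⟧ * (⟦ b ⟧ * φ (e ⊕ f) + lin q (λ f → φ (e ⊕ f)))             ∎

  -- Multiplication is convolution over `_⊕_`. In this form the laws of the product follow from
  -- those of `_⊕_` and from `lin-swap`.
  lin-* : ∀ p q φ → lin (p *ₚ q) φ ≈ lin p (λ e → lin q (λ f → φ (e ⊕ f)))
  lin-* []            q φ = refl
  lin-* ((a , e) ∷ p) q φ = begin
    lin (List.map _ q ++ (p *ₚ q)) φ                                              ≈⟨ lin-++ (List.map _ q) (p *ₚ q) φ ⟩
    lin (List.map _ q) φ + lin (p *ₚ q) φ                                         ≈⟨ +-cong (lin-scale a e q φ) (lin-* p q φ) ⟩
    ⟦ a ⟧ * lin q (λ f → φ (e ⊕ f)) + lin p (λ e → lin q (λ f → φ (e ⊕ f)))       ∎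

-- The commutative ring of polynomials

module PolyRing (A : CommutativeRing c ℓ) (m : ℕ) where
  open Ring A
  open Coeff A {m} public
  open Linear (idHom A) {m}
  open ≈-Reasoning

  δ : Exponent → Exponent → Carrier
  δ e e′ = if does (Vec.≡-dec ℕ._≟_ e′ e) then 1# else 0#

  coeff≈lin : ∀ p e → coeff p e ≈ lin p (δ e)
  coeff≈lin []             e = refl
  coeff≈lin ((a , e′) ∷ p) e with Vec.≡-dec ℕ._≟_ e′ e
  ... | yes _ = +-cong (sym (*-identityʳ a)) (coeff≈lin p e)
  ... | no  _ = trans (coeff≈lin p e) (sym (trans (+-congʳ (zeroʳ a)) (+-identityˡ _)))

  -- A record, so that p and q can be inferred from a proof of p ≋ q.
  infix 4 _≋_

  record _≋_ (p q : Poly rawRing m) : Set ℓ where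
    constructor mk≋
    field
      coeff≈ : p ≈ₚ q

  open _≋_ public

  -- Coefficients are the functionals `δ e`. Ring laws can therefore be checked on an arbitrary `φ`,
  -- without case distinctions on exponents.
  lin⇒≋ : ∀ {p q} → (∀ φ → lin p φ ≈ lin q φ) → p ≋ q
  lin⇒≋ {p} {q} eq .coeff≈ e = trans (coeff≈lin p e) (trans (eq (δ e)) (sym (coeff≈lin q e)))

  private
    lin-con : ∀ a φ → lin (con a) φ ≈ a * φ (replicate m 0)
    lin-con a φ = +-identityʳ _

    ⊕-identityˡ : ∀ {m} (e : Vec ℕ m) → replicate m 0 ⊕ e ≡ e
    ⊕-identityˡ = Vec.zipWith-identityˡ (λ _ → ≡.refl)

    ≋-refl : ∀ {p} → p ≋ p
    ≋-refl .coeff≈ _ = refl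

    ≋-sym : ∀ {p q} → p ≋ q → q ≋ p
    ≋-sym p≋q .coeff≈ e = sym (p≋q .coeff≈ e)

    ≋-trans : ∀ {p q r} → p ≋ q → q ≋ r → p ≋ r
    ≋-trans p≋q q≋r .coeff≈ e = trans (p≋q .coeff≈ e) (q≋r .coeff≈ e)

    ++-cong : ∀ {p p′ q q′} → p ≋ p′ → q ≋ q′ → p ++ q ≋ p′ ++ q′
    ++-cong {p} {p′} {q} {q′} p≋ q≋ .coeff≈ e =
      trans (coeff-++ p q e) (trans (+-cong (p≋ .coeff≈ e) (q≋ .coeff≈ e)) (sym (coeff-++ p′ q′ e)))

    ++-assoc : ∀ p q r → (p ++ q) ++ r ≋ p ++ (q ++ r)
    ++-assoc p q r .coeff≈ e = reflexive (≡.cong (λ s → coeff s e) (List.++-assoc p q r))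

    ++-identityʳ : ∀ p → p ++ [] ≋ p
    ++-identityʳ p .coeff≈ e = trans (coeff-++ p [] e) (+-identityʳ _)

    ++-comm : ∀ p q → p ++ q ≋ q ++ p
    ++-comm p q .coeff≈ e = trans (coeff-++ p q e) (trans (+-comm _ _) (sym (coeff-++ q p e)))

    neg-cong : ∀ {p q} → p ≋ q → neg p ≋ neg q
    neg-cong {p} {q} p≋q .coeff≈ e = trans (coeff-neg p e) (trans (-‿cong (p≋q .coeff≈ e)) (sym (coeff-neg q e)))

    neg-inverseˡ : ∀ p → neg p ++ p ≋ []
    neg-inverseˡ p .coeff≈ e = trans (coeff-++ (neg p) p e) (trans (+-congʳ (coeff-neg p e)) (-‿inverseˡ _))

    *ₚ-cong : ∀ {p p′ q q′} → p ≋ p′ → q ≋ q′ → p *ₚ q ≋ p′ *ₚ q′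
    *ₚ-cong {p} {p′} {q} {q′} p≋ q≋ = lin⇒≋ λ φ → begin
      lin (p *ₚ q) φ                            ≈⟨ lin-* p q φ ⟩
      lin p (λ e → lin q (λ f → φ (e ⊕ f)))     ≈⟨ lin-cong p p′ _ (p≋ .coeff≈) ⟩
      lin p′ (λ e → lin q (λ f → φ (e ⊕ f)))    ≈⟨ lin-congʳ p′ (λ e → lin-cong q q′ _ (q≋ .coeff≈)) ⟩
      lin p′ (λ e → lin q′ (λ f → φ (e ⊕ f)))   ≈⟨ lin-* p′ q′ φ ⟨
      lin (p′ *ₚ q′) φ                          ∎

    *ₚ-comm : ∀ p q → p *ₚ q ≋ q *ₚ p
    *ₚ-comm p q = lin⇒≋ λ φ → begin
      lin (p *ₚ q) φ                            ≈⟨ lin-* p q φ ⟩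
      lin p (λ e → lin q (λ f → φ (e ⊕ f)))     ≈⟨ lin-swap p q _ ⟩
      lin q (λ f → lin p (λ e → φ (e ⊕ f)))     ≈⟨ lin-congʳ q (λ f → lin-congʳ p (λ e → reflexive (≡.cong φ (Vec.zipWith-comm ℕ.+-comm e f)))) ⟩
      lin q (λ f → lin p (λ e → φ (f ⊕ e)))     ≈⟨ lin-* q p φ ⟨
      lin (q *ₚ p) φ                            ∎

    *ₚ-assoc : ∀ p q r → (p *ₚ q) *ₚ r ≋ p *ₚ (q *ₚ r)
    *ₚ-assoc p q r = lin⇒≋ λ φ → begin
      lin ((p *ₚ q) *ₚ r) φ                                        ≈⟨ lin-* (p *ₚ q) r φ ⟩
      lin (p *ₚ q) (λ e → lin r (λ g → φ (e ⊕ g)))                 ≈⟨ lin-* p q _ ⟩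
      lin p (λ e → lin q (λ f → lin r (λ g → φ ((e ⊕ f) ⊕ g))))    ≈⟨ lin-congʳ p (λ e → lin-congʳ q λ f → lin-congʳ r λ g → reflexive (≡.cong φ (Vec.zipWith-assoc ℕ.+-assoc e f g))) ⟩
      lin p (λ e → lin q (λ f → lin r (λ g → φ (e ⊕ (f ⊕ g)))))    ≈⟨ lin-congʳ p (λ e → lin-* q r _) ⟨
      lin p (λ e → lin (q *ₚ r) (λ f → φ (e ⊕ f)))                 ≈⟨ lin-* p (q *ₚ r) φ ⟨
      lin (p *ₚ (q *ₚ r)) φ                                        ∎

    *ₚ-identityˡ : ∀ p → con 1# *ₚ p ≋ p
    *ₚ-identityˡ p = lin⇒≋ λ φ → begin
      lin (con 1# *ₚ p) φ                                ≈⟨ lin-* (con 1#) p φ ⟩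
      lin (con 1#) (λ e → lin p (λ f → φ (e ⊕ f)))       ≈⟨ lin-con 1# (λ e → lin p (λ f → φ (e ⊕ f))) ⟩
      1# * lin p (λ f → φ (replicate m 0 ⊕ f))           ≈⟨ *-identityˡ _ ⟩
      lin p (λ f → φ (replicate m 0 ⊕ f))                ≈⟨ lin-congʳ p (λ f → reflexive (≡.cong φ (⊕-identityˡ f))) ⟩
      lin p φ                                            ∎

    *ₚ-distribʳ : ∀ p q r → (q ++ r) *ₚ p ≋ (q *ₚ p) ++ (r *ₚ p)
    *ₚ-distribʳ p q r = lin⇒≋ λ φ → begin
      lin ((q ++ r) *ₚ p) φ                                     ≈⟨ lin-* (q ++ r) p φ ⟩
      lin (q ++ r) (λ e → lin p (λ f → φ (e ⊕ f)))              ≈⟨ lin-++ q r _ ⟩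
      lin q (λ e → lin p (λ f → φ (e ⊕ f))) + lin r (λ e → lin p (λ f → φ (e ⊕ f))) ≈⟨ +-cong (lin-* q p φ) (lin-* r p φ) ⟨
      lin (q *ₚ p) φ + lin (r *ₚ p) φ                           ≈⟨ lin-++ (q *ₚ p) (r *ₚ p) φ ⟨
      lin ((q *ₚ p) ++ (r *ₚ p)) φ                              ∎

  ≋-isCommutativeRing : IsCommutativeRing _≋_ _++_ _*ₚ_ neg [] (con 1#)
  ≋-isCommutativeRing = record
      { isRing = record
        { +-isAbelianGroup = record
          { isGroup = record
            { isMonoid = record
              { isSemigroup = record
                { isMagma = record
                  { isEquivalence = record { refl = ≋-refl ; sym = ≋-sym ; trans = ≋-trans }
                  ; ∙-cong = ++-cong
                  }
                ; assoc = ++-assoc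
                }
              ; identity = (λ _ → ≋-refl) , ++-identityʳ
              }
            ; inverse = neg-inverseˡ , λ p → ≋-trans (++-comm p (neg p)) (neg-inverseˡ p)
            ; ⁻¹-cong = neg-cong
            }
          ; comm = ++-comm
          }
        ; *-cong = *ₚ-cong
        ; *-assoc = *ₚ-assoc
        ; *-identity = *ₚ-identityˡ , λ p → ≋-trans (*ₚ-comm p (con 1#)) (*ₚ-identityˡ p)
        ; distrib = (λ p q r → ≋-trans (*ₚ-comm p (q ++ r))
                      (≋-trans (*ₚ-distribʳ p q r) (++-cong (*ₚ-comm q p) (*ₚ-comm r p))))
                  , *ₚ-distribʳ
        }
      ; *-comm = *ₚ-comm
      }

infix 9 _[X_]

_[X_] : CommutativeRing c ℓ → ℕ → CommutativeRing c ℓ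
(A [X m ]) .CommutativeRing.Carrier = Poly (CommutativeRing.rawRing A) m
(A [X m ]) .CommutativeRing._≈_ = PolyRing._≋_ A m
(A [X m ]) .CommutativeRing._+_ = _++_
(A [X m ]) .CommutativeRing._*_ = PolyRing._*ₚ_ A m
(A [X m ]) .CommutativeRing.-_ = PolyRing.neg A m
(A [X m ]) .CommutativeRing.0# = []
(A [X m ]) .CommutativeRing.1# = PolyRing.con A m (CommutativeRing.1# A)
(A [X m ]) .CommutativeRing.isCommutativeRing = PolyRing.≋-isCommutativeRing A m

-- Evaluation at points of an algebra, and substitution

module _ {B : CommutativeRing c ℓ} {m : ℕ} where
  open Ring B

  monomial : (Fin m → Carrier) → Vec ℕ m → Carrier
  monomial ρ e = product λ i → ρ i ^ lookup e i

  monomial-⊕ : ∀ ρ e f → monomial ρ (e ⊕ f) ≈ monomial ρ e * monomial ρ f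
  monomial-⊕ ρ e f = trans
    (product-cong (λ i → trans (reflexive (≡.cong (ρ i ^_) (Vec.lookup-zipWith ℕ._+_ i e f))) (^-homo-* (ρ i) (lookup e i) (lookup f i))))
    (product-distrib-* (λ i → ρ i ^ lookup e i) (λ i → ρ i ^ lookup f i))

  monomial-0 : ∀ ρ → monomial ρ (replicate m 0) ≈ 1#
  monomial-0 ρ = trans (product-cong λ i → reflexive (≡.cong (ρ i ^_) (Vec.lookup-replicate i 0))) (product-replicate-one m)

module _ {A B : CommutativeRing c ℓ} {m : ℕ} where
  private
    module A = Ring A
  open Ring B
  open ≈-Reasoning

  eval : Hom A B → (Fin m → Carrier) → Poly A.rawRing m → Carrier
  eval ι ρ p = Linear.lin ι p (monomial {B = B} ρ)

  module _ (ι : Hom A B) where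
    open Hom ι
    open Linear ι {m}
    open Coeff A {m} using (_*ₚ_)

    eval-congʳ : ∀ {ρ ρ′} → (∀ i → ρ i ≈ ρ′ i) → ∀ p → eval ι ρ p ≈ eval ι ρ′ p
    eval-congʳ ρ≈ p = lin-congʳ p λ e → product-cong λ i → ^-congˡ (lookup e i) (ρ≈ i)

    eval-congˡ : ∀ (ι′ : Hom A B) → (∀ a → ⟦ a ⟧ ≈ Hom.⟦_⟧ ι′ a) → ∀ ρ p → eval ι ρ p ≈ eval ι′ ρ p
    eval-congˡ ι′ ι≈ ρ []            = refl
    eval-congˡ ι′ ι≈ ρ ((a , e) ∷ p) = +-cong (*-congʳ (ι≈ a)) (eval-congˡ ι′ ι≈ ρ p)

    eval-con : ∀ ρ a → eval ι ρ (Coeff.con A a) ≈ ⟦ a ⟧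
    eval-con ρ a = trans (+-identityʳ _) (trans (*-congˡ (monomial-0 {B = B} ρ)) (*-identityʳ _))

    evalHom : (Fin m → Carrier) → Hom (A [X m ]) B
    evalHom ρ .Hom.⟦_⟧ = eval ι ρ
    evalHom ρ .Hom.⟦⟧-cong {p} {q} p≋q = lin-cong p q (monomial {B = B} ρ) (PolyRing.coeff≈ p≋q)
    evalHom ρ .Hom.+-homo p q = lin-++ p q (monomial {B = B} ρ)
    evalHom ρ .Hom.*-homo p q = begin
          lin (p *ₚ q) (monomial {B = B} ρ)                               ≈⟨ lin-* p q (monomial {B = B} ρ) ⟩
          lin p (λ e → lin q (λ f → monomial {B = B} ρ (e ⊕ f)))          ≈⟨ lin-congʳ p (λ e → lin-congʳ q (λ f → monomial-⊕ {B = B} ρ e f)) ⟩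
          lin p (λ e → lin q (λ f → monomial {B = B} ρ e * monomial {B = B} ρ f)) ≈⟨ lin-congʳ p (λ e → trans (lin-*ʳ q _ _) (*-comm _ _)) ⟩
          lin p (λ e → eval ι ρ q * monomial {B = B} ρ e)                 ≈⟨ lin-*ʳ p _ _ ⟩
          eval ι ρ q * eval ι ρ p                                 ≈⟨ *-comm _ _ ⟩
          eval ι ρ p * eval ι ρ q                                 ∎
    evalHom ρ .Hom.0-homo = refl
    evalHom ρ .Hom.1-homo = trans (eval-con ρ A.1#) 1-homo

module _ {A B : CommutativeRing c ℓ} (ι : Hom A B) where
  private
    module A = Ring A
  open Ring B
  open Hom ι

  private
    monomial-unit : ∀ {m} (ρ : Fin m → Carrier) i → monomial {B = B} ρ (replicate m 0 Vec.[ i ]≔ 1) ≈ ρ i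
    monomial-unit ρ zero    = trans (*-cong (*-identityʳ _) (monomial-0 {B = B} (ρ ∘ suc))) (*-identityʳ _)
    monomial-unit ρ (suc i) = trans (*-identityˡ _) (monomial-unit (ρ ∘ suc) i)

  eval-var : ∀ {m} (ρ : Fin m → Carrier) i → eval ι ρ (Coeff.var A i) ≈ ρ i
  eval-var ρ i = trans (+-identityʳ _) (trans (*-congʳ 1-homo) (trans (*-identityˡ _) (monomial-unit ρ i)))

eval-natural : {A B C : CommutativeRing c ℓ} (ι : Hom A B) (f : Hom B C) → let open Ring C in
  ∀ {m} (ρ : Fin m → CommutativeRing.Carrier B) p →
  Hom.⟦_⟧ f (eval ι ρ p) ≈ eval (f ∘ʰ ι) (Hom.⟦_⟧ f ∘ ρ) p
eval-natural         ι f ρ []            = Hom.0-homo f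
eval-natural {B = B} {C} ι f ρ ((a , e) ∷ p) = begin
  ⟦ ι.⟦ a ⟧ B.* monomial {B = B} ρ e B.+ eval ι ρ p ⟧       ≈⟨ +-homo _ _ ⟩
  ⟦ ι.⟦ a ⟧ B.* monomial {B = B} ρ e ⟧ + ⟦ eval ι ρ p ⟧     ≈⟨ +-cong (*-homo _ _) (eval-natural ι f ρ p) ⟩
  ⟦ ι.⟦ a ⟧ ⟧ * ⟦ monomial {B = B} ρ e ⟧ + eval (f ∘ʰ ι) (⟦_⟧ ∘ ρ) p ≈⟨ +-congʳ (*-congˡ (trans (product-homo (λ i → ρ i B.^ lookup e i)) (product-cong λ i → ^-homo (ρ i) (lookup e i)))) ⟩
  ⟦ ι.⟦ a ⟧ ⟧ * monomial {B = C} (⟦_⟧ ∘ ρ) e + eval (f ∘ʰ ι) (⟦_⟧ ∘ ρ) p ∎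
  where
  module ι = Hom ι
  module B = Ring B
  open Hom f
  open Ring C
  open ≈-Reasoning

module _ {A : CommutativeRing c ℓ} {m : ℕ} where
  open Ring A
  open PolyRing A m
  open Linear (idHom A) {m}
  open ≈-Reasoning
  private
    module A[X] = Ring (A [X m ])

  lin-mono : ∀ a e φ → lin ((a , e) ∷ []) φ ≈ a * φ e
  lin-mono a e φ = +-identityʳ _

  coeff-sum : ∀ {n} (f : Fin n → A[X].Carrier) e → coeff (A[X].sum f) e ≈ sum (λ i → coeff (f i) e)
  coeff-sum {zero}  f e = refl
  coeff-sum {suc n} f e = trans (coeff-++ (f zero) _ e) (+-congˡ (coeff-sum (f ∘ suc) e))

  coeff-con-* : ∀ a p e → coeff (con a *ₚ p) e ≈ a * coeff p e
  coeff-con-* a p e = begin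
    coeff (con a *ₚ p) e                              ≈⟨ coeff≈lin (con a *ₚ p) e ⟩
    lin (con a *ₚ p) (δ e)                            ≈⟨ lin-* (con a) p (δ e) ⟩
    lin (con a) (λ e′ → lin p (λ f → δ e (e′ ⊕ f)))   ≈⟨ lin-mono a (replicate m 0) (λ e′ → lin p (λ f → δ e (e′ ⊕ f))) ⟩
    a * lin p (λ f → δ e (replicate m 0 ⊕ f))         ≈⟨ *-congˡ (lin-congʳ p λ f → reflexive (≡.cong (δ e) (Vec.zipWith-identityˡ (λ _ → ≡.refl) f))) ⟩
    a * lin p (δ e)                                   ≈⟨ *-congˡ (coeff≈lin p e) ⟨
    a * coeff p e                                     ∎

  coeff-*-con : ∀ a p e → coeff (p *ₚ con a) e ≈ coeff p e * a
  coeff-*-con a p e = trans (A[X].*-comm p (con a) .coeff≈ e) (trans (coeff-con-* a p e) (*-comm _ _))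

module _ (A : CommutativeRing c ℓ) (m : ℕ) where
  open Ring A
  open PolyRing A m

  conHom : Hom A (A [X m ])
  conHom .Hom.⟦_⟧ = con
  conHom .Hom.⟦⟧-cong a≈b = lin⇒≋ λ φ → +-congʳ (*-congʳ a≈b)
  conHom .Hom.+-homo a b = lin⇒≋ λ φ →
        trans (lin-mono {A = A} _ (replicate m 0) φ) (trans (distribʳ _ _ _) (+-congˡ (sym (+-identityʳ _))))
  conHom .Hom.*-homo a b = lin⇒≋ λ φ →
        +-congʳ (*-congˡ (reflexive (≡.cong φ (≡.sym (Vec.zipWith-identityˡ (λ _ → ≡.refl) (replicate m 0))))))
  conHom .Hom.0-homo = lin⇒≋ λ φ → trans (lin-mono {A = A} _ (replicate m 0) φ) (zeroˡ _)
  conHom .Hom.1-homo = CommutativeRing.refl (A [X m ])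

coeff-con-0 : {A : CommutativeRing c ℓ} → let open Ring A in ∀ {m} a → Coeff.coeff A (Coeff.con A {m} a) (replicate m 0) ≈ a
coeff-con-0 {A = A} {m} a = trans (Coeff.coeff-here A a (replicate m 0) []) (+-identityʳ a)
  where open Ring A

-- _^_ is parametrised by the whole raw ring, and polyRing and A [X m ] differ in their equality relations.
module _ {A : CommutativeRing c ℓ} {m m′ : ℕ} where
  open Ring A using (rawRing)
  private
    module R = RawSemiringDefs (RawRing.rawSemiring (polyRing rawRing m′))
    module A[X] = Ring (A [X m′ ])

    ^≡^ : ∀ p k → p R.^ k ≡ p A[X].^ k
    ^≡^ p zero    = ≡.refl
    ^≡^ p (suc k) = ≡.cong (p A[X].*_) (^≡^ p k)

    product≡product : ∀ {n} {f g : Fin n → A[X].Carrier} → (∀ i → f i ≡ g i) → R.product f ≡ A[X].product g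
    product≡product {zero}  f≡g = ≡.refl
    product≡product {suc n} f≡g = ≡.cong₂ A[X]._*_ (f≡g zero) (product≡product (f≡g ∘ suc))

  compose≡eval : ∀ (p : Poly rawRing m) g → compose rawRing p g ≡ eval (conHom A m′) g p
  compose≡eval []            g = ≡.refl
  compose≡eval ((a , e) ∷ p) g = ≡.cong₂ A[X]._+_
    (≡.cong (Coeff.con A a A[X].*_) (product≡product λ i → ^≡^ (g i) (lookup e i)))
    (compose≡eval p g)

eval-compose : {A B : CommutativeRing c ℓ} (ι : Hom A B) → let open Ring B in
  ∀ {m m′} (p : Poly (CommutativeRing.rawRing A) m) (g : Fin m → Poly (CommutativeRing.rawRing A) m′) ρ →
  eval ι ρ (compose (CommutativeRing.rawRing A) p g) ≈ eval ι (eval ι ρ ∘ g) p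
eval-compose {A = A} {B} ι {m′ = m′} p g ρ = trans
  (trans (reflexive (≡.cong (eval ι ρ) (compose≡eval {A = A} p g))) (eval-natural (conHom A m′) (evalHom ι ρ) g p))
  (eval-congˡ (evalHom ι ρ ∘ʰ conHom A m′) ι (eval-con ι ρ) _ p)
  where open Ring B

module _ {A : CommutativeRing c ℓ} {m : ℕ} where
  open Ring A
  private
    module P = PolyRing A m
    module Q = PolyRing A (suc m)
    module L = Linear (idHom A) {m}
    module M = Linear (idHom A) {suc m}
    module A[X] = CommutativeRing (A [X suc m ])
  open ≈-Reasoning

  -- Adjoins a new first variable, so that inductions on the number of variables can split off
  -- `var zero`.
  shift : Poly rawRing m → Poly rawRing (suc m)
  shift = List.map (map₂ (0 ∷_))

  lin-shift : ∀ p φ → M.lin (shift p) φ ≈ L.lin p (λ e → φ (0 ∷ e))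
  lin-shift []      φ = refl
  lin-shift (_ ∷ p) φ = +-congˡ (lin-shift p φ)

  shiftHom : Hom (A [X m ]) (A [X suc m ])
  shiftHom .Hom.⟦_⟧ = shift
  shiftHom .Hom.⟦⟧-cong {p} {q} p≋q = Q.lin⇒≋ λ φ →
        trans (lin-shift p φ) (trans (L.lin-cong p q _ (P.coeff≈ p≋q)) (sym (lin-shift q φ)))
  shiftHom .Hom.+-homo p q = A[X].reflexive (List.map-++ _ p q)
  shiftHom .Hom.*-homo p q = Q.lin⇒≋ λ φ → begin
        M.lin (shift (p P.*ₚ q)) φ                                     ≈⟨ lin-shift (p P.*ₚ q) φ ⟩
        L.lin (p P.*ₚ q) (λ e → φ (0 ∷ e))                             ≈⟨ L.lin-* p q _ ⟩
        L.lin p (λ e → L.lin q (λ f → φ (0 ∷ (e ⊕ f))))                ≈⟨ L.lin-congʳ p (λ e → sym (lin-shift q (λ f → φ ((0 ∷ e) ⊕ f)))) ⟩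
        L.lin p (λ e → M.lin (shift q) (λ f → φ ((0 ∷ e) ⊕ f)))        ≈⟨ lin-shift p (λ e → M.lin (shift q) (λ f → φ (e ⊕ f))) ⟨
        M.lin (shift p) (λ e → M.lin (shift q) (λ f → φ (e ⊕ f)))      ≈⟨ M.lin-* (shift p) (shift q) φ ⟨
        M.lin (shift p Q.*ₚ shift q) φ                                 ∎
  shiftHom .Hom.0-homo = A[X].refl
  shiftHom .Hom.1-homo = A[X].refl

module _ {A : CommutativeRing c ℓ} where
  open Ring A

  var₀-^ : ∀ {m} k → let open Ring (A [X suc m ]) using () renaming (_^_ to _^′_; _≈_ to _≈′_) in
    (Coeff.var A zero ^′ k) ≈′ ((1# , k ∷ replicate m 0) ∷ [])
  var₀-^     zero    = Ring.refl (A [X suc _ ])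
  var₀-^ {m} (suc k) = A[X].trans (A[X].*-congˡ {Coeff.var A zero} (var₀-^ k)) (PolyRing.lin⇒≋ A (suc m) λ φ →
    +-congʳ (*-cong (*-identityˡ _) (reflexive (≡.cong (λ e → φ (suc k ∷ e)) (Vec.zipWith-identityˡ (λ _ → ≡.refl) _)))))
    where
    module A[X] = Ring (A [X suc m ])

  monomial-var : ∀ {m} (e : Vec ℕ m) → let open Ring (A [X m ]) using () renaming (_≈_ to _≈′_) in
    monomial {B = A [X m ]} (Coeff.var A) e ≈′ ((1# , e) ∷ [])
  monomial-var         []      = Ring.refl (A [X 0 ])
  monomial-var {suc m} (k ∷ e) = begin
    var zero ^′ k *′ product′ (λ i → shift {A = A} (Coeff.var A i) ^′ lookup e i)    ≈⟨ A[X].*-cong (var₀-^ k) (A[X].product-cong λ i → A[X].sym (^-homo (Coeff.var A i) (lookup e i))) ⟩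
    mono 1# (k ∷ replicate m 0) *′ product′ (λ i → shift {A = A} (Coeff.var A i A[X]ₘ.^ lookup e i)) ≈⟨ A[X].*-congˡ {mono 1# (k ∷ replicate m 0)} (product-homo (λ i → Coeff.var A i A[X]ₘ.^ lookup e i)) ⟨
    mono 1# (k ∷ replicate m 0) *′ shift {A = A} (monomial {B = A [X m ]} (Coeff.var A) e) ≈⟨ A[X].*-congˡ {mono 1# (k ∷ replicate m 0)} (⟦⟧-cong (monomial-var e)) ⟩
    mono 1# (k ∷ replicate m 0) *′ mono 1# (0 ∷ e)                          ≈⟨ PolyRing.lin⇒≋ A (suc m) (λ φ → +-congʳ (*-cong (*-identityˡ 1#)
      (reflexive (≡.cong φ (≡.cong₂ _∷_ (ℕ.+-identityʳ k) (Vec.zipWith-identityˡ (λ _ → ≡.refl) e)))))) ⟩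
    mono 1# (k ∷ e)                                                          ∎
    where
    module A[X] = Ring (A [X suc m ])
    module A[X]ₘ = Ring (A [X m ])
    open A[X].≈-Reasoning
    open A[X] using () renaming (_^_ to _^′_; _*_ to _*′_; product to product′)
    open Coeff A using (var)
    open Hom (shiftHom {A = A} {m})
    mono : Carrier → Vec ℕ (suc m) → A[X].Carrier
    mono a e = (a , e) ∷ []

-- At the generic point a polynomial evaluates to itself. This is the passage from vanishing at
-- points of all algebras to vanishing of coefficients.
coeff-eval-var : {A B : CommutativeRing c ℓ} (ι : Hom A B) → let open Ring B in
  ∀ {m} (p : Poly (CommutativeRing.rawRing A) m) e →
  Coeff.coeff B (eval (conHom B m ∘ʰ ι) (Coeff.var B) p) e ≈ Hom.⟦_⟧ ι (Coeff.coeff A p e)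
coeff-eval-var         {B = B} ι     []             e = Ring.sym B (Hom.0-homo ι)
coeff-eval-var {A = A} {B = B} ι {m} ((a , e′) ∷ p) e = begin
  coeff (con ⟦ a ⟧ *ₚ M ++ eval (conHom B m ∘ʰ ι) var p) e        ≈⟨ coeff-++ (con ⟦ a ⟧ *ₚ M) _ e ⟩
  coeff (con ⟦ a ⟧ *ₚ M) e + coeff (eval (conHom B m ∘ʰ ι) var p) e ≈⟨ +-cong (coeff-con-* {A = B} ⟦ a ⟧ M e) (coeff-eval-var ι p e) ⟩
  ⟦ a ⟧ * coeff M e + ⟦ Coeff.coeff A p e ⟧                   ≈⟨ +-congʳ (*-congˡ (coeff≈ (monomial-var {A = B} e′) e)) ⟩
  ⟦ a ⟧ * coeff ((1# , e′) ∷ []) e + ⟦ Coeff.coeff A p e ⟧    ≈⟨ last ⟩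
  ⟦ Coeff.coeff A ((a , e′) ∷ p) e ⟧                          ∎
  where
  open Hom ι
  open Ring B
  open ≈-Reasoning
  open PolyRing B m
  M = monomial {B = B [X m ]} var e′
  last : ⟦ a ⟧ * coeff ((1# , e′) ∷ []) e + ⟦ Coeff.coeff A p e ⟧ ≈ ⟦ Coeff.coeff A ((a , e′) ∷ p) e ⟧
  last with Vec.≡-dec ℕ._≟_ e′ e
  ... | yes _ = trans (+-congʳ (trans (*-congˡ (+-identityʳ 1#)) (*-identityʳ _))) (sym (+-homo _ _))
  ... | no  _ = trans (+-congʳ (zeroʳ _)) (+-identityˡ _)

-- Univariate polynomials

module _ {A : CommutativeRing c ℓ} where
  open Ring A
  open PolyRing A 1
  open Linear (idHom A) {1}
  open ≈-Reasoning

  coeff₁ : Poly rawRing 1 → ℕ → Carrier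
  coeff₁ p x = coeff p (x ∷ [])

  private
    lin-sumʳ : ∀ p {n} (φ : Fin n → Exponent → Carrier) → lin p (λ e → sum (λ x → φ x e)) ≈ sum (λ x → lin p (φ x))
    lin-sumʳ p {zero}  φ = lin-0ʳ p
    lin-sumʳ p {suc n} φ = trans (lin-+ʳ p _ _) (+-congˡ (lin-sumʳ p (φ ∘ suc)))

    -- Only the index `x = f` can contribute, and then `e = D ∸ f`. The recursion lowers `D` and `f`
    -- together until this index is the first one, or until `D` runs out and both sides are zero.
    δ-antidiagonal : ∀ D e f → sum {suc D} (λ x → δ (D ∸ toℕ x ∷ []) (e ∷ []) * δ (toℕ x ∷ []) (f ∷ [])) ≈ δ (D ∷ []) (e ℕ.+ f ∷ [])
    δ-antidiagonal zero    e zero    = trans (+-identityʳ _) (trans (*-identityʳ _) (reflexive (≡.cong (λ s → δ (0 ∷ []) (s ∷ [])) (≡.sym (ℕ.+-identityʳ e)))))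
    δ-antidiagonal zero    e (suc f) = trans (+-identityʳ _) (trans (zeroʳ _) (reflexive (≡.cong (λ s → δ (0 ∷ []) (s ∷ [])) (≡.sym (ℕ.+-suc e f)))))
    δ-antidiagonal (suc D) e zero    = trans (+-cong (*-identityʳ _) (sum-zero {suc D} (λ x → δ (D ∸ toℕ x ∷ []) (e ∷ []) * 0#) λ x → zeroʳ _)) (trans (+-identityʳ _) (reflexive (≡.cong (λ s → δ (suc D ∷ []) (s ∷ [])) (≡.sym (ℕ.+-identityʳ e)))))
    δ-antidiagonal (suc D) e (suc f) = trans (+-cong (zeroʳ _) (δ-antidiagonal D e f)) (trans (+-identityˡ _) (reflexive (≡.cong (λ s → δ (suc D ∷ []) (s ∷ [])) (≡.sym (ℕ.+-suc e f)))))

  coeff₁-* : ∀ p q D → coeff₁ (p *ₚ q) D ≈ sum {suc D} (λ x → coeff₁ p (D ∸ toℕ x) * coeff₁ q (toℕ x))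
  coeff₁-* p q D = begin
    coeff (p *ₚ q) (D ∷ [])                                                   ≈⟨ coeff≈lin (p *ₚ q) _ ⟩
    lin (p *ₚ q) (δ (D ∷ []))                                                 ≈⟨ lin-* p q _ ⟩
    lin p (λ e → lin q (λ f → δ (D ∷ []) (e ⊕ f)))                            ≈⟨ lin-congʳ p (λ e → lin-congʳ q (λ f → antidiagonal e f)) ⟨
    lin p (λ e → lin q (λ f → sum {suc D} (λ x → δ₁ x e * δ₂ x f)))           ≈⟨ lin-congʳ p (λ e → lin-sumʳ q (λ x f → δ₁ x e * δ₂ x f)) ⟩
    lin p (λ e → sum {suc D} (λ x → lin q (λ f → δ₁ x e * δ₂ x f)))           ≈⟨ lin-sumʳ p (λ x e → lin q (λ f → δ₁ x e * δ₂ x f)) ⟩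
    sum {suc D} (λ x → lin p (λ e → lin q (λ f → δ₁ x e * δ₂ x f)))           ≈⟨ sum-cong-≋ (λ x → separate x) ⟩
    sum {suc D} (λ x → coeff₁ p (D ∸ toℕ x) * coeff₁ q (toℕ x))               ∎
    where
    δ₁ δ₂ : Fin (suc D) → Exponent → Carrier
    δ₁ x = δ (D ∸ toℕ x ∷ [])
    δ₂ x = δ (toℕ x ∷ [])
    antidiagonal : ∀ e f → sum (λ x → δ₁ x e * δ₂ x f) ≈ δ (D ∷ []) (e ⊕ f)
    antidiagonal (e ∷ []) (f ∷ []) = δ-antidiagonal D e f
    separate : ∀ x → lin p (λ e → lin q (λ f → δ₁ x e * δ₂ x f)) ≈ coeff₁ p (D ∸ toℕ x) * coeff₁ q (toℕ x)
    separate x = begin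
      lin p (λ e → lin q (λ f → δ₁ x e * δ₂ x f)) ≈⟨ lin-congʳ p (λ e → trans (lin-*ʳ q _ _) (*-comm _ _)) ⟩
      lin p (λ e → lin q (δ₂ x) * δ₁ x e)         ≈⟨ lin-*ʳ p _ _ ⟩
      lin q (δ₂ x) * lin p (δ₁ x)                 ≈⟨ *-comm _ _ ⟩
      lin p (δ₁ x) * lin q (δ₂ x)                 ≈⟨ *-cong (coeff≈lin p _) (coeff≈lin q _) ⟨
      coeff₁ p (D ∸ toℕ x) * coeff₁ q (toℕ x)     ∎

  -- The specialisation of the variable to zero; it is applied below to the scale `t`.
  constantTerm : Hom (A [X 1 ]) A
  constantTerm .Hom.⟦_⟧ p = coeff₁ p 0
  constantTerm .Hom.⟦⟧-cong p≋q = coeff≈ p≋q (0 ∷ [])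
  constantTerm .Hom.+-homo p q = coeff-++ p q (0 ∷ [])
  constantTerm .Hom.*-homo p q = trans (coeff₁-* p q 0) (+-identityʳ _)
  constantTerm .Hom.0-homo = refl
  constantTerm .Hom.1-homo = coeff-con-0 {A = A} {1} 1#

-- The coefficient of the `x`-th power of the first variable, as a polynomial in the remaining ones.
slice : {A : Set c} {m : ℕ} → ℕ → List (A × Vec ℕ (suc m)) → List (A × Vec ℕ m)
slice x []                = []
slice x ((a , k ∷ e) ∷ p) = if k ℕ.≡ᵇ x then (a , e) ∷ slice x p else slice x p

coeff-slice : {A : CommutativeRing c ℓ} → let open Ring A in
  ∀ {m} x (p : Poly rawRing (suc m)) e → Coeff.coeff A (slice x p) e ≈ Coeff.coeff A p (x ∷ e)
coeff-slice {A = A} x []                 e = Ring.refl A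
coeff-slice {A = A} x ((a , k ∷ e′) ∷ p) e with k ℕ.≡ᵇ x
... | false = coeff-slice {A = A} x p e
... | true with does (Vec.≡-dec ℕ._≟_ e′ e)
...   | true  = Ring.+-congˡ A (coeff-slice {A = A} x p e)
...   | false = coeff-slice {A = A} x p e

-- The first variable stays formal, in `B [X 1 ]`, while the others take constant values. An
-- identity known in every algebra can thus be split by the powers of one variable with the others
-- at arbitrary points.
eval-slice : {A B : CommutativeRing c ℓ} (ι : Hom A B) → let open Ring B in
  ∀ {m} (u : Fin m → Carrier) (p : Poly (CommutativeRing.rawRing A) (suc m)) x →
  coeff₁ {A = B} (eval (conHom B 1 ∘ʰ ι) (Coeff.var B zero ◂ Coeff.con B ∘ u) p) x ≈ eval ι u (slice x p)
eval-slice {B = B} ι     u []                x = Ring.refl B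
eval-slice {B = B} ι {m} u ((a , k ∷ e) ∷ p) x = begin
  coeff₁ {A = B} (con ⟦ a ⟧ *ₚ (T *ₚ U) ++ E) x             ≈⟨ coeff-++ (con ⟦ a ⟧ *ₚ (T *ₚ U)) E _ ⟩
  coeff₁ {A = B} (con ⟦ a ⟧ *ₚ (T *ₚ U)) x + coeff₁ {A = B} E x     ≈⟨ +-cong (coeff-con-* {A = B} ⟦ a ⟧ (T *ₚ U) _) (eval-slice ι u p x) ⟩
  ⟦ a ⟧ * coeff₁ {A = B} (T *ₚ U) x + eval ι u (slice x p)  ≈⟨ +-congʳ (*-congˡ (coeff≈ (B[X].*-cong (var₀-^ {A = B} {0} k) U≋) _)) ⟩
  ⟦ a ⟧ * coeff₁ {A = B} (((1# , k ∷ []) ∷ []) *ₚ con M) x + eval ι u (slice x p) ≈⟨ +-congʳ (*-congˡ (coeff-*-con {A = B} M ((1# , k ∷ []) ∷ []) (x ∷ []))) ⟩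
  ⟦ a ⟧ * (coeff₁ {A = B} ((1# , k ∷ []) ∷ []) x * M) + eval ι u (slice x p) ≈⟨ last ⟩
  eval ι u (slice x ((a , k ∷ e) ∷ p))                      ∎
  where
  open Hom ι
  open Ring B
  open ≈-Reasoning
  open PolyRing B 1
  module B[X] = Ring (B [X 1 ])
  T U E : B[X].Carrier
  T = var zero B[X].^ k
  U = monomial {B = B [X 1 ]} (con ∘ u) e
  E = eval (conHom B 1 ∘ʰ ι) (var zero ◂ con ∘ u) p
  M = monomial {B = B} u e
  U≋ : U B[X].≈ con M
  U≋ = B[X].sym (B[X].trans (Hom.product-homo (conHom B 1) (λ i → u i ^ lookup e i))
    (B[X].product-cong λ i → Hom.^-homo (conHom B 1) (u i) (lookup e i)))
  last : ⟦ a ⟧ * (coeff₁ {A = B} ((1# , k ∷ []) ∷ []) x * M) + eval ι u (slice x p) ≈ eval ι u (slice x ((a , k ∷ e) ∷ p))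
  last with k ℕ.≡ᵇ x
  ... | true  = +-congʳ (*-congˡ (trans (*-congʳ (+-identityʳ 1#)) (*-identityˡ _)))
  ... | false = trans (+-congʳ (trans (*-congˡ (zeroˡ _)) (zeroʳ _))) (+-identityˡ _)

sum-single : (A : CommutativeRing c ℓ) → let open Ring A in
  ∀ {n} (f : Fin n → Carrier) i → (∀ j → j ≢ i → f j ≈ 0#) → sum f ≈ f i
sum-single A f zero    f≈0 = trans (+-congˡ (sum-zero (f ∘ suc) λ j → f≈0 (suc j) λ ())) (+-identityʳ _)
  where open Ring A
sum-single A f (suc i) f≈0 = trans (+-cong (f≈0 zero λ ()) (sum-single A (f ∘ suc) i λ j j≢i → f≈0 (suc j) (j≢i ∘ Fin.suc-injective))) (+-identityˡ _)
  where open Ring A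

-- Triangular submatrices and rank over a Heyting field

module Field (𝔽 : HeytingField c ℓ₁ ℓ₂) where
  K : CommutativeRing c ℓ₁
  K = fieldCommutativeRing 𝔽

  open Ring K
  open HeytingField 𝔽 using (_#_; tight; #-cotrans; #⇒invertible)
  open ≈-Reasoning

  -- Tightness of the apartness. It lets an equation be proved from an existence claim that holds
  -- only up to double negation.
  ≈0-by-contradiction : ∀ {x} → ¬ (x # 0#) → x ≈ 0#
  ≈0-by-contradiction {x} = proj₁ (tight x 0#)

  ≈0⇒¬# : ∀ {x} → x ≈ 0# → ¬ (x # 0#)
  ≈0⇒¬# {x} = proj₂ (tight x 0#)

  #0-resp-≈ : ∀ {x y} → x ≈ y → x # 0# → y # 0#
  #0-resp-≈ {x} {y} x≈y x#0 with #-cotrans x#0 y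
  ... | inj₁ x#y = contradiction x#y (proj₂ (tight x y) x≈y)
  ... | inj₂ y#0 = y#0

  inverse : ∀ {x} → x # 0# → ∃[ x⁻¹ ] x⁻¹ * x ≈ 1#
  inverse {x} x#0 with #⇒invertible x#0
  ... | x⁻¹ , x⁻¹*[x-0]≈1 , _ = x⁻¹ , trans (*-congˡ (sym (trans (+-congˡ -0#≈0#) (+-identityʳ x)))) x⁻¹*[x-0]≈1

  -- The listed rows and columns, in list order, form a lower triangular matrix with invertible
  -- diagonal, so its rank is the length of the list.
  Triangular : {P Q : Set} → (P → Q → Carrier) → List (P × Q) → Set (ℓ₁ ⊔ ℓ₂)
  Triangular V []            = ⊤
  Triangular V ((p , q) ∷ L) = V p q # 0# × All (λ (p′ , q′) → V p q′ ≈ 0#) L × Triangular V L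

  -- Agreement is asked only on the listed columns, because the elimination in `no-longer` changes
  -- the entries of all columns that are not orthogonal to the first row.
  Triangular-resp : {P Q : Set} {V V′ : P → Q → Carrier} (L : List (P × Q)) →
    All (λ (_ , q) → ∀ p → V p q ≈ V′ p q) L → Triangular V L → Triangular V′ L
  Triangular-resp []            []        _                 = tt
  Triangular-resp ((p , q) ∷ L) (eq ∷ eqs) (pq#0 , z , tri) =
    #0-resp-≈ (eq p) pq#0 , All.zipWith (λ (eq , v≈0) → trans (sym (eq p)) v≈0) (eqs , z) , Triangular-resp L eqs tri

  -- After the first pair all β q′ lie in the hyperplane orthogonal to α p, so a coordinate l with α p l # 0# can be
  -- eliminated.
  private
    no-longer : ∀ {P Q : Set} w (α : P → Fin w → Carrier) (β : Q → Fin w → Carrier) L →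
      Triangular (λ p q → sum (λ l → α p l * β q l)) L → ¬ (w ℕ.< length L)
    no-longer zero    α β ((p , q) ∷ L) (pq#0 , _ , _) _ = ≈0⇒¬# refl pq#0
    no-longer (suc w) α β ((p , q) ∷ L) (pq#0 , z , tri) (ℕ.s≤s w<L) =
      -- If no coordinate of `α p` is apart from zero, then all are zero and so is the diagonal
      -- entry at `p` and `q`.
      ≈0⇒¬# (sum-zero (λ l → α p l * β q l) λ l → trans (*-congʳ (≈0-by-contradiction (eliminate l))) (zeroˡ _)) pq#0
      where
      eliminate : ∀ l → ¬ (α p l # 0#)
      eliminate l αₗ#0 with inverse αₗ#0
      ... | y , y*αₗ≈1 = no-longer w α′ β′ L (Triangular-resp L (All.map (λ {(_ , q′)} v≈0 p′ → unchanged p′ q′ v≈0) z) tri) w<L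
        where
        -- Orthogonality to `α p` expresses `β q′ l` as `- y` times the sum of the other products.
        -- Substituting this into row `p′` removes coordinate `l`.
        α′ = λ p′ i → α p′ (punchIn l i) + - (α p′ l * y) * α p (punchIn l i)
        β′ = λ q′ i → β q′ (punchIn l i)
        unchanged : ∀ p′ q′ → sum (λ l → α p l * β q′ l) ≈ 0# → sum (λ l → α p′ l * β q′ l) ≈ sum (λ i → α′ p′ i * β′ q′ i)
        unchanged p′ q′ v≈0 = sym (begin
          sum (λ i → α′ p′ i * β′ q′ i)                                 ≈⟨ sum-cong-≋ {w} (λ i → trans (distribʳ _ _ _) (+-congˡ (*-assoc _ _ _))) ⟩
          sum (λ i → A p′ i + - (α p′ l * y) * A p i)                   ≈⟨ ∑-distrib-+ (A p′) (λ i → - (α p′ l * y) * A p i) ⟩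
          sum (A p′) + sum (λ i → - (α p′ l * y) * A p i)               ≈⟨ +-congˡ (*-distribˡ-sum _ (A p)) ⟨
          sum (A p′) + - (α p′ l * y) * sum (A p)                       ≈⟨ +-congˡ (-‿distribˡ-* _ _) ⟨
          sum (A p′) + - (α p′ l * y * sum (A p))                       ≈⟨ +-congˡ (-‿distribʳ-* _ _) ⟩
          sum (A p′) + α p′ l * y * - sum (A p)                         ≈⟨ +-congˡ (*-congˡ -A≈) ⟩
          sum (A p′) + α p′ l * y * (α p l * β q′ l)                    ≈⟨ +-congˡ (*-assoc _ _ _) ⟩
          sum (A p′) + α p′ l * (y * (α p l * β q′ l))                  ≈⟨ +-congˡ (*-congˡ (*-assoc _ _ _)) ⟨
          sum (A p′) + α p′ l * (y * α p l * β q′ l)                    ≈⟨ +-congˡ (*-congˡ (trans (*-congʳ y*αₗ≈1) (*-identityˡ _))) ⟩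
          sum (A p′) + α p′ l * β q′ l                                  ≈⟨ +-comm _ _ ⟩
          α p′ l * β q′ l + sum (A p′)                                  ≈⟨ sum-remove {i = l} (λ l → α p′ l * β q′ l) ⟨
          sum (λ l → α p′ l * β q′ l)                                   ∎)
          where
          A : _ → Fin w → Carrier
          A p i = α p (punchIn l i) * β q′ (punchIn l i)
          -A≈ : - sum (A p) ≈ α p l * β q′ l
          -A≈ = begin
            - sum (A p)                                       ≈⟨ +-identityˡ _ ⟨
            0# + - sum (A p)                                  ≈⟨ +-congʳ v≈0 ⟨
            sum (λ l → α p l * β q′ l) + - sum (A p)          ≈⟨ +-congʳ (sum-remove {i = l} (λ l → α p l * β q′ l)) ⟩
            (α p l * β q′ l + sum (A p)) + - sum (A p)        ≈⟨ +-assoc _ _ _ ⟩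
            α p l * β q′ l + (sum (A p) + - sum (A p))        ≈⟨ +-congˡ (-‿inverseʳ _) ⟩
            α p l * β q′ l + 0#                               ≈⟨ +-identityʳ _ ⟩
            α p l * β q′ l                                    ∎

  triangular-length : ∀ {P Q : Set} w (α : P → Fin w → Carrier) (β : Q → Fin w → Carrier) L →
    Triangular (λ p q → sum (λ l → α p l * β q l)) L → length L ℕ.≤ w
  triangular-length w α β L tri = ℕ.≮⇒≥ (no-longer w α β L tri)

  -- V a b is the coefficient of U^a Y^b in a polynomial in U_1, …, U_m and Y_1, …, Y_{m+r} that vanishes on U_i = Y_i
  -- for each i ≤ m.
  DiagonalFree : ∀ m r → (Vec ℕ m → Vec ℕ (m ℕ.+ r) → Carrier) → Set ℓ₁
  DiagonalFree zero    r V = ⊤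
  DiagonalFree (suc m) r V =
      -- Replacing both first variables by a single one collects the powers with `x + y = D`. The
      -- second component says that every coefficient with respect to this pair vanishes on the
      -- remaining diagonals.
      (∀ D a b → sum {suc D} (λ x → V (toℕ x ∷ a) (D ∸ toℕ x ∷ b)) ≈ 0#)
    × (∀ x y → DiagonalFree m r (λ a b → V (x ∷ a) (y ∷ b)))

  private
    cons₂ : ∀ {m n} → ℕ → ℕ → Vec ℕ m × Vec ℕ n → Vec ℕ (suc m) × Vec ℕ (suc n)
    cons₂ x y = map× (x ∷_) (y ∷_)

    Triangular-cons : ∀ {m n} (V : Vec ℕ (suc m) → Vec ℕ (suc n) → Carrier) x y L →
      Triangular (λ a b → V (x ∷ a) (y ∷ b)) L → Triangular V (List.map (cons₂ x y) L)
    Triangular-cons V x y []      _               = tt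
    Triangular-cons V x y (_ ∷ L) (v#0 , z , tri) = v#0 , All.map⁺ z , Triangular-cons V x y L tri

    -- A block triangular matrix: only the block with rows `x` and columns `y′` has to be zero, and
    -- the opposite block is arbitrary.
    Triangular-++ : ∀ {m n} (V : Vec ℕ (suc m) → Vec ℕ (suc n) → Carrier) {x y x′ y′} L L′ →
      (∀ a b → V (x ∷ a) (y′ ∷ b) ≈ 0#) →
      Triangular (λ a b → V (x ∷ a) (y ∷ b)) L → Triangular (λ a b → V (x′ ∷ a) (y′ ∷ b)) L′ →
      Triangular V (List.map (cons₂ x y) L ++ List.map (cons₂ x′ y′) L′)
    Triangular-++ V {x′ = x′} {y′} []            L′ xy′≈0 _               tri′ = Triangular-cons V x′ y′ L′ tri′
    Triangular-++ V               ((a , b) ∷ L) L′ xy′≈0 (v#0 , z , tri) tri′ =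
      v#0 , All.++⁺ (All.map⁺ z) (All.map⁺ (All.universal (λ (_ , b′) → xy′≈0 a b′) L′)) , Triangular-++ V L L′ xy′≈0 tri tri′

  -- The lowest nonzero antidiagonal x + y = D for the first pair of variables has zero sum, so it contains two nonzero
  -- blocks; the block with the smaller x and the smaller y lies below that antidiagonal, hence is zero.
  large-triangular : ∀ m r V → DiagonalFree m r V → ∀ a b → V a b # 0# →
    ¬ ¬ (∃[ L ] length L ≡ 2 ℕ.^ m × Triangular V L)
  large-triangular zero    r V _             a b ab#0 k = k ((a , b) ∷ [] , ≡.refl , ab#0 , [] , tt)
  large-triangular (suc m) r V (diag , free) (x ∷ a) (y ∷ b) ab#0 k =
    ≈0⇒¬# (vanish (x ℕ.+ y) x y ≡.refl a b) ab#0
    where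
    Vanish : ℕ → Set ℓ₁
    Vanish D = ∀ x y → x ℕ.+ y ≡ D → ∀ a b → V (x ∷ a) (y ∷ b) ≈ 0#

    -- Each nonzero block contains a triangular list of length `2 ^ m` by induction. Their
    -- concatenation has twice that length and contradicts `k`, which denies that such a list
    -- exists.
    two-blocks : ∀ {x y x′ y′ a b a′ b′} → (∀ a b → V (x ∷ a) (y′ ∷ b) ≈ 0#) →
      V (x ∷ a) (y ∷ b) # 0# → V (x′ ∷ a′) (y′ ∷ b′) # 0# → ⊥
    two-blocks {x} {y} {x′} {y′} xy′≈0 v#0 v′#0 =
      large-triangular m r _ (free x y) _ _ v#0 λ (L , |L| , tri) →
      large-triangular m r _ (free x′ y′) _ _ v′#0 λ (L′ , |L′| , tri′) →
      k (List.map (cons₂ x y) L ++ List.map (cons₂ x′ y′) L′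
        , ≡.trans (List.length-++ (List.map (cons₂ x y) L)) (≡.cong₂ ℕ._+_ (≡.trans (List.length-map _ L) |L|)
            (≡.trans (≡.trans (List.length-map _ L′) |L′|) (≡.sym (ℕ.+-identityʳ _))))
        , Triangular-++ V L L′ xy′≈0 tri tri′)

    step : ∀ D → (∀ {D′} → D′ ℕ.< D → Vanish D′) → Vanish D
    step D below x y x+y≡D a b = ≈0-by-contradiction λ v#0 → ≈0⇒¬# (begin
      V (x ∷ a) (y ∷ b)     ≡⟨ ≡.cong₂ (λ x y → V (x ∷ a) (y ∷ b)) (≡.sym toℕ-i) (≡.sym D∸i) ⟩
      f i                   ≈⟨ sum-single K f i (others v#0) ⟨
      sum f                 ≈⟨ diag D a b ⟩
      0#                    ∎) v#0
      where
      f : Fin (suc D) → Carrier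
      f x = V (toℕ x ∷ a) (D ∸ toℕ x ∷ b)
      x<1+D : x ℕ.< suc D
      x<1+D = ℕ.s≤s (≡.subst (x ℕ.≤_) x+y≡D (ℕ.m≤m+n x y))
      i : Fin (suc D)
      i = fromℕ< x<1+D
      toℕ-i : toℕ i ≡ x
      toℕ-i = Fin.toℕ-fromℕ< x<1+D
      D∸i : D ∸ toℕ i ≡ y
      D∸i = ≡.trans (≡.cong₂ _∸_ (≡.sym x+y≡D) toℕ-i) (ℕ.m+n∸m≡n x y)
      others : V (x ∷ a) (y ∷ b) # 0# → ∀ j → j ≢ i → f j ≈ 0#
      others v#0 j j≢i = ≈0-by-contradiction λ v′#0 → compare v′#0
        where
        j+D∸j : toℕ j ℕ.+ (D ∸ toℕ j) ≡ D
        j+D∸j = ℕ.m+[n∸m]≡n (ℕ.≤-pred (Fin.toℕ<n j))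
        compare : ¬ (f j # 0#)
        compare v′#0 with ℕ.<-cmp x (toℕ j)
        ... | tri< x<j _ _ = two-blocks (below (≡.subst (x ℕ.+ (D ∸ toℕ j) ℕ.<_) j+D∸j (ℕ.+-monoˡ-< _ x<j)) x (D ∸ toℕ j) ≡.refl) v#0 v′#0
        ... | tri≈ _ x≡j _ = j≢i (Fin.toℕ-injective (≡.trans (≡.sym x≡j) (≡.sym toℕ-i)))
        ... | tri> _ _ j<x = two-blocks (below (≡.subst (toℕ j ℕ.+ y ℕ.<_) x+y≡D (ℕ.+-monoˡ-< y j<x)) (toℕ j) y ≡.refl) v′#0 v#0

    vanish : ∀ D → Vanish D
    vanish = <-rec Vanish step

  module _ {w m r : ℕ} (g : Fin w → Poly rawRing m) (η : Fin w → Poly rawRing r) where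
    private
      module Kʳ = PolyRing K r
      module Kᵐ = PolyRing K m

    -- The coefficient matrix of the sum of the products `η l` times `g l`, in separate variables.
    -- It factors through `w` coordinates; `pairing` gives the values of the same polynomial.
    tensor : Vec ℕ m → Vec ℕ r → Carrier
    tensor a b = sum λ l → Kʳ.coeff (η l) b * Kᵐ.coeff (g l) a

    pairing : (B : CommutativeRing c ℓ₁) → Hom K B → (Fin m → CommutativeRing.Carrier B) → (Fin r → CommutativeRing.Carrier B) → CommutativeRing.Carrier B
    pairing B ι u y = Ring.sum B λ l → Ring._*_ B (eval ι y (η l)) (eval ι u (g l))

    -- With `u` substituted first, the sum is a polynomial over `B` in the variables of `η`. Its
    -- coefficient at `b` is the value at `u` of the polynomial whose coefficients are the
    -- `tensor a b`, so it is zero.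
    tensor≈0⇒pairing≈0 : (∀ a b → tensor a b ≈ 0#) → ∀ B ι u y → Ring._≈_ B (pairing B ι u y) (Ring.0# B)
    tensor≈0⇒pairing≈0 t≈0 B ι u y = R.begin
      B.sum (λ l → eval ι y (η l) B.* eval ι u (g l))                    R.≈⟨ B.sum-cong-≋ {w} (λ l → B.*-comm _ _) ⟩
      B.sum (λ l → eval ι u (g l) B.* eval ι y (η l))                    R.≈⟨ B.sum-cong-≋ {w} (λ l → B.*-cong (B.sym (eval-con (idHom B) y _)) (eval-y (η l))) ⟩
      B.sum (λ l → Y.⟦ con (eval ι u (g l)) ⟧ B.* Y.⟦ generic (η l) ⟧)   R.≈⟨ B.sum-cong-≋ {w} (λ l → B.sym (Y.*-homo (con (eval ι u (g l))) (generic (η l)))) ⟩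
      B.sum (λ l → Y.⟦ con (eval ι u (g l)) *ₚ generic (η l) ⟧)          R.≈⟨ Y.sum-homo (λ l → con (eval ι u (g l)) *ₚ generic (η l)) ⟨
      Y.⟦ B[Y].sum (λ l → con (eval ι u (g l)) *ₚ generic (η l)) ⟧       R.≈⟨ Y.⟦⟧-cong {B[Y].sum (λ l → con (eval ι u (g l)) *ₚ generic (η l))} {[]} (mk≋ q≈0) ⟩
      B.0#                                                               R.∎
      where
      module B = Ring B
      module R = B.≈-Reasoning
      module ι = Hom ι
      module U = Hom (evalHom ι u)
      module Y = Hom (evalHom (idHom B) y)
      module B[Y] = Ring (B [X r ])
      module K[U] = Ring (K [X m ])
      open PolyRing B r
      generic : Poly rawRing r → B[Y].Carrier
      generic = eval (conHom B r ∘ʰ ι) var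
      eval-y : ∀ p → eval ι y p B.≈ Y.⟦ generic p ⟧
      eval-y p = B.sym (B.trans (eval-natural (conHom B r ∘ʰ ι) (evalHom (idHom B) y) var p)
        (B.trans (eval-congʳ (evalHom (idHom B) y ∘ʰ conHom B r ∘ʰ ι) (eval-var (idHom B) y) p)
          (eval-congˡ (evalHom (idHom B) y ∘ʰ conHom B r ∘ʰ ι) ι (λ a → eval-con (idHom B) y ι.⟦ a ⟧) y p)))
      column : ∀ b → B.sum (λ l → ι.⟦ Kʳ.coeff (η l) b ⟧ B.* eval ι u (g l)) B.≈ B.0#
      column b = R.begin
        B.sum (λ l → ι.⟦ Kʳ.coeff (η l) b ⟧ B.* eval ι u (g l))            R.≈⟨ B.sum-cong-≋ {w} (λ l → B.*-congʳ (eval-con ι u _)) ⟨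
        B.sum (λ l → U.⟦ Kᵐ.con (Kʳ.coeff (η l) b) ⟧ B.* U.⟦ g l ⟧)        R.≈⟨ B.sum-cong-≋ {w} (λ l → U.*-homo (Kᵐ.con (Kʳ.coeff (η l) b)) (g l)) ⟨
        B.sum (λ l → U.⟦ Kᵐ.con (Kʳ.coeff (η l) b) Kᵐ.*ₚ g l ⟧)            R.≈⟨ U.sum-homo (λ l → Kᵐ.con (Kʳ.coeff (η l) b) Kᵐ.*ₚ g l) ⟨
        U.⟦ K[U].sum (λ l → Kᵐ.con (Kʳ.coeff (η l) b) Kᵐ.*ₚ g l) ⟧         R.≈⟨ U.⟦⟧-cong {K[U].sum (λ l → Kᵐ.con (Kʳ.coeff (η l) b) Kᵐ.*ₚ g l)} {[]} (Kᵐ.mk≋ λ a →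
          trans (coeff-sum {A = K} (λ l → Kᵐ.con (Kʳ.coeff (η l) b) Kᵐ.*ₚ g l) a)
            (trans (sum-cong-≋ {w} λ l → coeff-con-* {A = K} (Kʳ.coeff (η l) b) (g l) a) (t≈0 a b))) ⟩
        B.0#                                                               R.∎
      q≈0 : ∀ b → coeff (B[Y].sum (λ l → con (eval ι u (g l)) *ₚ generic (η l))) b B.≈ B.0#
      q≈0 b = R.begin
        coeff (B[Y].sum (λ l → con (eval ι u (g l)) *ₚ generic (η l))) b   R.≈⟨ coeff-sum {A = B} (λ l → con (eval ι u (g l)) *ₚ generic (η l)) b ⟩
        B.sum (λ l → coeff (con (eval ι u (g l)) *ₚ generic (η l)) b)      R.≈⟨ B.sum-cong-≋ {w} (λ l → coeff-con-* {A = B} (eval ι u (g l)) (generic (η l)) b) ⟩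
        B.sum (λ l → eval ι u (g l) B.* coeff (generic (η l)) b)           R.≈⟨ B.sum-cong-≋ {w} (λ l → B.trans (B.*-congˡ (coeff-eval-var ι (η l) b)) (B.*-comm _ _)) ⟩
        B.sum (λ l → ι.⟦ Kʳ.coeff (η l) b ⟧ B.* eval ι u (g l))            R.≈⟨ column b ⟩
        B.0#                                                               R.∎

-- From vanishing on diagonals to vanishing coefficients

module Rank (𝔽 : HeytingField c ℓ₁ ℓ₂) where
  open Field 𝔽
  open Ring K
  open ≈-Reasoning

  -- The outer sum is there for antidiagonals, where several pairings of slices vanish only
  -- together.
  PairingVanishes : ∀ {m r n w} → (Fin n → Fin w → Poly rawRing m) → (Fin n → Fin w → Poly rawRing r) → Set (lsuc (c ⊔ ℓ₁))
  PairingVanishes g η = ∀ B ι u y → let open Ring B using () renaming (sum to sum′; _≈_ to _≈′_; 0# to 0′) in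
    sum′ (λ x → pairing (g x) (η x) B ι u y) ≈′ 0′

  module _ {m r n w : ℕ} (g : Fin n → Fin w → Poly rawRing m) (η : Fin n → Fin w → Poly rawRing r)
           (pairing≈0 : PairingVanishes g η) where
    private
      coeff-sum₂ : ∀ (B : CommutativeRing c ℓ₁) {k} (f : Fin n → Fin w → Ring.Carrier (B [X k ])) (h : Fin n → Fin w → Ring.Carrier B) e →
        Ring._≈_ (B [X k ]) (Ring.sum (B [X k ]) λ x → Ring.sum (B [X k ]) (f x)) [] →
        (∀ x l → Ring._≈_ B (Coeff.coeff B (f x l) e) (h x l)) →
        Ring._≈_ B (Ring.sum B λ x → Ring.sum B (h x)) (Ring.0# B)
      coeff-sum₂ B {k} f h e f≈0 f≈h = R.begin
        B.sum (λ x → B.sum (λ l → h x l))              R.≈⟨ B.sum-cong-≋ {n} (λ x → B.sum-cong-≋ {w} (λ l → f≈h x l)) ⟨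
        B.sum (λ x → B.sum (λ l → coeff (f x l) e))    R.≈⟨ B.sum-cong-≋ {n} (λ x → coeff-sum {A = B} (f x) e) ⟨
        B.sum (λ x → coeff (B[X].sum (f x)) e)         R.≈⟨ coeff-sum {A = B} (λ x → B[X].sum (f x)) e ⟨
        coeff (B[X].sum (λ x → B[X].sum (f x))) e      R.≈⟨ coeff≈ f≈0 e ⟩
        B.0#                                           R.∎
        where
        module B = Ring B
        module R = B.≈-Reasoning
        module B[X] = Ring (B [X k ])
        open PolyRing B k

      coeff-left : ∀ B (ι : Hom K B) y a → let module B = Ring B in
        B.sum (λ x → B.sum (λ l → eval ι y (η x l) B.* Hom.⟦_⟧ ι (Coeff.coeff K (g x l) a))) B.≈ B.0#
      coeff-left B ι y a = coeff-sum₂ B (λ x l → eval (conHom B m ∘ʰ ι) (con ∘ y) (η x l) *ₚ eval (conHom B m ∘ʰ ι) var (g x l)) _ a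
        (pairing≈0 (B [X m ]) (conHom B m ∘ʰ ι) var (con ∘ y))
        λ x l → R.begin
          coeff (eval (conHom B m ∘ʰ ι) (con ∘ y) (η x l) *ₚ eval (conHom B m ∘ʰ ι) var (g x l)) a
            R.≈⟨ coeff≈ (B[X].*-congʳ {eval (conHom B m ∘ʰ ι) var (g x l)} (eval-natural ι (conHom B m) y (η x l))) a ⟨
          coeff (con (eval ι y (η x l)) *ₚ eval (conHom B m ∘ʰ ι) var (g x l)) a
            R.≈⟨ coeff-con-* {A = B} (eval ι y (η x l)) (eval (conHom B m ∘ʰ ι) var (g x l)) a ⟩
          eval ι y (η x l) B.* coeff (eval (conHom B m ∘ʰ ι) var (g x l)) a
            R.≈⟨ B.*-congˡ (coeff-eval-var ι (g x l) a) ⟩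
          eval ι y (η x l) B.* Hom.⟦_⟧ ι (Coeff.coeff K (g x l) a) R.∎
        where
        module B = Ring B
        module R = B.≈-Reasoning
        module B[X] = Ring (B [X m ])
        open PolyRing B m

    -- Two generic points in turn: `coeff-left` makes the variables of `g` generic and reads off `a`
    -- with `y` arbitrary, then `y` is itself taken generic and `b` is read off.
    pairing≈0⇒tensor≈0 : ∀ a b → sum (λ x → tensor (g x) (η x) a b) ≈ 0#
    pairing≈0⇒tensor≈0 a b = coeff-sum₂ K (λ x l → eval ι var (η x l) *ₚ con (Coeff.coeff K (g x l) a)) _ b
      (coeff-left (K [X r ]) ι var a)
      λ x l → trans (coeff-*-con {A = K} (Coeff.coeff K (g x l) a) (eval ι var (η x l)) b)
        (*-congʳ (coeff-eval-var (idHom K) (η x l) b))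
      where
      open PolyRing K r
      ι = conHom K r ∘ʰ idHom K

  -- The counterpart of `DiagonalFree` for values. In this form it can be obtained by substituting
  -- into `F`, and `diagonalFree` translates it into coefficients.
  VanishesOnDiagonals : ∀ m r {w} → (Fin w → Poly rawRing m) → (Fin w → Poly rawRing (m ℕ.+ r)) → Set (lsuc (c ⊔ ℓ₁))
  VanishesOnDiagonals m r g η = ∀ i B (ι : Hom K B) u y → let open Ring B using () renaming (_≈_ to _≈′_; 0# to 0′) in
    u i ≈′ y (i ↑ˡ r) → pairing g η B ι u y ≈′ 0′

  module _ {m r w : ℕ} (g : Fin w → Poly rawRing (suc m)) (η : Fin w → Poly rawRing (suc m ℕ.+ r))
           (vanishes : VanishesOnDiagonals (suc m) r g η) where
    private
      module _ (B : CommutativeRing c ℓ₁) (ι : Hom K B) where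
        module B = Ring B
        module R = B.≈-Reasoning
        module B[X] = Ring (B [X 1 ])
        open PolyRing B 1

        ι̂ : Hom K (B [X 1 ])
        ι̂ = conHom B 1 ∘ʰ ι

        -- Both first variables receive the same formal value, a point of the first diagonal over
        -- `B [X 1 ]`. The sum is the coefficient of degree `D` there.
        antidiagonal : ∀ D u y →
          B.sum {suc D} (λ x → pairing (slice (toℕ x) ∘ g) (slice (D ∸ toℕ x) ∘ η) B ι u y) B.≈ B.0#
        antidiagonal D u y = R.begin
          B.sum {suc D} (λ x → B.sum (λ l → eval ι y (slice (D ∸ toℕ x) (η l)) B.* eval ι u (slice (toℕ x) (g l))))
            R.≈⟨ B.∑-comm (λ (x : Fin (suc D)) (l : Fin w) → eval ι y (slice (D ∸ toℕ x) (η l)) B.* eval ι u (slice (toℕ x) (g l))) ⟩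
          B.sum (λ l → B.sum {suc D} (λ x → eval ι y (slice (D ∸ toℕ x) (η l)) B.* eval ι u (slice (toℕ x) (g l))))
            R.≈⟨ B.sum-cong-≋ {w} (λ l → B.sum-cong-≋ {suc D} (λ x → B.*-cong (eval-slice ι y (η l) (D ∸ toℕ x)) (eval-slice ι u (g l) (toℕ x)))) ⟨
          B.sum (λ l → B.sum {suc D} (λ x → coeff₁ {A = B} (η̂ l) (D ∸ toℕ x) B.* coeff₁ {A = B} (ĝ l) (toℕ x)))
            R.≈⟨ B.sum-cong-≋ {w} (λ l → coeff₁-* {A = B} (η̂ l) (ĝ l) D) ⟨
          B.sum (λ l → coeff₁ {A = B} (η̂ l *ₚ ĝ l) D)
            R.≈⟨ coeff-sum {A = B} (λ l → η̂ l *ₚ ĝ l) (D ∷ []) ⟨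
          coeff₁ {A = B} (B[X].sum (λ l → η̂ l *ₚ ĝ l)) D
            R.≈⟨ coeff≈ (vanishes zero (B [X 1 ]) ι̂ (var zero ◂ con ∘ u) (var zero ◂ con ∘ y) B[X].refl) (D ∷ []) ⟩
          B.0# R.∎
          where
          η̂ ĝ : Fin w → B[X].Carrier
          η̂ l = eval ι̂ (var zero ◂ con ∘ y) (η l)
          ĝ l = eval ι̂ (var zero ◂ con ∘ u) (g l)

        slice-left : ∀ x i u y → u i B.≈ y (suc i ↑ˡ r) → pairing (slice x ∘ g) η B ι u y B.≈ B.0#
        slice-left x i u y uᵢ≈yᵢ = R.begin
          B.sum (λ l → eval ι y (η l) B.* eval ι u (slice x (g l)))
            R.≈⟨ B.sum-cong-≋ {w} (λ l → B.*-congˡ (eval-slice ι u (g l) x)) ⟨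
          B.sum (λ l → eval ι y (η l) B.* coeff₁ {A = B} (ĝ l) x)
            R.≈⟨ B.sum-cong-≋ {w} (λ l → coeff-con-* {A = B} (eval ι y (η l)) (ĝ l) (x ∷ [])) ⟨
          B.sum (λ l → coeff₁ {A = B} (con (eval ι y (η l)) *ₚ ĝ l) x)
            R.≈⟨ coeff-sum {A = B} (λ l → con (eval ι y (η l)) *ₚ ĝ l) (x ∷ []) ⟨
          coeff₁ {A = B} (B[X].sum (λ l → con (eval ι y (η l)) *ₚ ĝ l)) x
            R.≈⟨ coeff≈ (B[X].sum-cong-≋ {w} (λ l → B[X].*-congʳ {ĝ l} (eval-natural ι (conHom B 1) y (η l)))) (x ∷ []) ⟩
          coeff₁ {A = B} (B[X].sum (λ l → eval ι̂ (con ∘ y) (η l) *ₚ ĝ l)) x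
            R.≈⟨ coeff≈ (vanishes (suc i) (B [X 1 ]) ι̂ (var zero ◂ con ∘ u) (con ∘ y) (Hom.⟦⟧-cong (conHom B 1) uᵢ≈yᵢ)) (x ∷ []) ⟩
          B.0# R.∎
          where
          ĝ : Fin w → B[X].Carrier
          ĝ l = eval ι̂ (var zero ◂ con ∘ u) (g l)

    -- The diagonal of a later pair does not restrict the first pair, so those two variables can be
    -- made formal one after the other: that of `g` in `slice-left`, that of `η` here.
    slices-vanish : ∀ x y → VanishesOnDiagonals m r (slice x ∘ g) (slice y ∘ η)
    slices-vanish x y i B ι u v uᵢ≈vᵢ = S.begin
      C.sum (λ l → eval ι v (slice y (η l)) C.* eval ι u (slice x (g l)))
        S.≈⟨ C.sum-cong-≋ {w} (λ l → C.*-congʳ (eval-slice ι v (η l) y)) ⟨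
      C.sum (λ l → coeff₁ {A = B} (η̂ l) y C.* eval ι u (slice x (g l)))
        S.≈⟨ C.sum-cong-≋ {w} (λ l → coeff-*-con {A = B} (eval ι u (slice x (g l))) (η̂ l) (y ∷ [])) ⟨
      C.sum (λ l → coeff₁ {A = B} (η̂ l *ₚ con (eval ι u (slice x (g l)))) y)
        S.≈⟨ coeff-sum {A = B} (λ l → η̂ l *ₚ con (eval ι u (slice x (g l)))) (y ∷ []) ⟨
      coeff₁ {A = B} (C[X].sum (λ l → η̂ l *ₚ con (eval ι u (slice x (g l))))) y
        S.≈⟨ coeff≈ (C[X].sum-cong-≋ {w} (λ l → C[X].*-congˡ {η̂ l} (eval-natural ι (conHom B 1) u (slice x (g l))))) (y ∷ []) ⟩
      coeff₁ {A = B} (C[X].sum (λ l → η̂ l *ₚ eval (conHom B 1 ∘ʰ ι) (con ∘ u) (slice x (g l)))) y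
        S.≈⟨ coeff≈ (slice-left (B [X 1 ]) (conHom B 1 ∘ʰ ι) x i (con ∘ u) (var zero ◂ con ∘ v) (Hom.⟦⟧-cong (conHom B 1) uᵢ≈vᵢ)) (y ∷ []) ⟩
      C.0# S.∎
      where
      module C = Ring B
      module S = C.≈-Reasoning
      module C[X] = Ring (B [X 1 ])
      open PolyRing B 1
      η̂ : Fin w → C[X].Carrier
      η̂ l = eval (conHom B 1 ∘ʰ ι) (var zero ◂ con ∘ v) (η l)

    tensor-antidiagonal : ∀ D a b → sum {suc D} (λ x → tensor g η (toℕ x ∷ a) (D ∸ toℕ x ∷ b)) ≈ 0#
    tensor-antidiagonal D a b = trans
      (sum-cong-≋ {suc D} λ x → sum-cong-≋ {w} λ l → sym (*-cong (coeff-slice {A = K} (D ∸ toℕ x) (η l) b) (coeff-slice {A = K} (toℕ x) (g l) a)))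
      (pairing≈0⇒tensor≈0 {n = suc D} (λ x → slice (toℕ x) ∘ g) (λ x → slice (D ∸ toℕ x) ∘ η) (λ B ι → antidiagonal B ι D) a b)

  private
    -- `V` is kept apart from `tensor g η` because slicing reproduces the coefficients only up to
    -- the equality of the ring.
    diagonalFree : ∀ m r {w} (g : Fin w → Poly rawRing m) (η : Fin w → Poly rawRing (m ℕ.+ r)) →
      VanishesOnDiagonals m r g η → ∀ V → (∀ a b → V a b ≈ tensor g η a b) → DiagonalFree m r V
    diagonalFree zero    r     g η vanishes V V≈ = tt
    diagonalFree (suc m) r {w} g η vanishes V V≈ =
        (λ D a b → trans (sum-cong-≋ {suc D} λ x → V≈ (toℕ x ∷ a) (D ∸ toℕ x ∷ b)) (tensor-antidiagonal g η vanishes D a b))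
      , λ x y → diagonalFree m r (slice x ∘ g) (slice y ∘ η) (slices-vanish g η vanishes x y) _ λ a b →
          trans (V≈ (x ∷ a) (y ∷ b)) (sum-cong-≋ {w} λ l → sym (*-cong (coeff-slice {A = K} y (η l) b) (coeff-slice {A = K} x (g l) a)))

  tensor-rank : ∀ m r {w} (g : Fin w → Poly rawRing m) (η : Fin w → Poly rawRing (m ℕ.+ r)) →
    w ℕ.< 2 ℕ.^ m → VanishesOnDiagonals m r g η → ∀ a b → tensor g η a b ≈ 0#
  tensor-rank m r {w} g η w<2^m vanishes a b = ≈0-by-contradiction λ ab#0 →
    large-triangular m r (tensor g η) (diagonalFree m r g η vanishes (tensor g η) λ _ _ → refl) a b ab#0
      λ (L , |L| , tri) → ℕ.<⇒≱ w<2^m (≡.subst (ℕ._≤ w) |L|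
        (triangular-length w (λ a l → Coeff.coeff K (g l) a) (λ b l → Coeff.coeff K (η l) b) L
          (Triangular-resp L (All.universal (λ (_ , b) a → sum-cong-≋ {w} λ l → *-comm _ _) L) tri)))

-- Points of the generator

permutation-injective : ∀ {N} (π : Permutation′ N) {i j} → π ⟨$⟩ʳ i ≡ π ⟨$⟩ʳ j → i ≡ j
permutation-injective π = Injection.injective (Inverse⇒Injection π)

module _ (A : CommutativeRing c ℓ) where
  open Ring A

  sum-++ : ∀ m {n} (f : Fin (m ℕ.+ n) → Carrier) → sum f ≈ sum (f ∘ (_↑ˡ n)) + sum (f ∘ (m ↑ʳ_))
  sum-++ zero    f = sym (+-identityˡ _)
  sum-++ (suc m) f = trans (+-congˡ (sum-++ m (f ∘ suc))) (sym (+-assoc _ _ _))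

  product-one : ∀ {n} (f : Fin n → Carrier) → (∀ i → f i ≈ 1#) → product f ≈ 1#
  product-one {n} f f≈1 = trans (product-cong f≈1) (product-replicate-one n)

  product-zero : ∀ {n} (f : Fin n → Carrier) i → f i ≈ 0# → product f ≈ 0#
  product-zero f zero    f₀≈0 = trans (*-congʳ f₀≈0) (zeroˡ _)
  product-zero f (suc i) fᵢ≈0 = trans (*-congˡ (product-zero (f ∘ suc) i fᵢ≈0)) (zeroʳ _)

module Generator {N n : ℕ} (code : Fin N → Fin n → Bool) where

  module _ (A : CommutativeRing c ℓ) where
    open Ring A

    select : Bool → Carrier → Carrier
    select b x = if b then x else 1# + - x

    -- The coefficient of `P` at the monomial of the subset labelled `i`; compare `coeff-product`.
    weight : (Fin n → Carrier) → Fin N → Carrier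
    weight ζ i = product λ t → select (code i t) (ζ t)

    point : ∀ {k} → (Fin k → Carrier) → (Fin k → Fin n → Carrier) → Fin N → Carrier
    point y z i = sum λ j → y j * weight (z j) i

    indicator : Fin N → Fin n → Carrier
    indicator i t = if code i t then 1# else 0#

    -- s is a formal scale: at s = 0 the point with these z is y_j at b j and 0 elsewhere.
    perturb : ∀ {k} → (Fin k → Fin N) → Carrier → (Fin k → Fin n → Carrier) → Fin k → Fin n → Carrier
    perturb b s ζ j t = indicator (b j) t + s * ζ j t

  module _ (A : CommutativeRing c ℓ) where
    open Ring A

    select-cong : ∀ b {x y} → x ≈ y → select A b x ≈ select A b y
    select-cong true  x≈y = x≈y
    select-cong false x≈y = +-congˡ (-‿cong x≈y)

    weight-cong : ∀ {ζ ζ′} i → (∀ t → ζ t ≈ ζ′ t) → weight A ζ i ≈ weight A ζ′ i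
    weight-cong i ζ≈ = product-cong λ t → select-cong (code i t) (ζ≈ t)

    point-cong : ∀ {k} {y y′ : Fin k → Carrier} {z z′} i →
      (∀ j → y j ≈ y′ j) → (∀ j t → z j t ≈ z′ j t) → point A y z i ≈ point A y′ z′ i
    point-cong {k} i y≈ z≈ = sum-cong-≋ {k} λ j → *-cong (y≈ j) (weight-cong i (z≈ j))

    1-0≈1 : 1# + - 0# ≈ 1#
    1-0≈1 = trans (+-congˡ -0#≈0#) (+-identityʳ 1#)

    weight-indicator-≡ : ∀ i → weight A (indicator A i) i ≈ 1#
    weight-indicator-≡ i = product-one A _ factor
      where
      factor : ∀ t → select A (code i t) (indicator A i t) ≈ 1#
      factor t with code i t
      ... | true  = refl
      ... | false = 1-0≈1

    module _ (code-injective : ∀ {i j} → (∀ t → code i t ≡ code j t) → i ≡ j) where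

      weight-indicator-≢ : ∀ {i j} → i ≢ j → weight A (indicator A i) j ≈ 0#
      weight-indicator-≢ {i} {j} i≢j
        with t , code≢ ← Fin.¬∀⟶∃¬ n (λ t → code i t ≡ code j t) (λ t → code i t Bool.≟ code j t) (i≢j ∘ code-injective)
        = product-zero A _ t (factor (code i t) (code j t) code≢)
        where
        factor : ∀ b b′ → b ≢ b′ → select A b′ (if b then 1# else 0#) ≈ 0#
        factor true  true  b≢b′ = contradiction ≡.refl b≢b′
        factor true  false _    = -‿inverseʳ 1#
        factor false true  _    = refl
        factor false false b≢b′ = contradiction ≡.refl b≢b′

      point-indicator : ∀ {k} (b : Fin k → Fin N) → (∀ {i j} → b i ≡ b j → i ≡ j) →
        ∀ y i → point A y (indicator A ∘ b) (b i) ≈ y i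
      point-indicator b b-injective y i = trans
        (sum-single A _ i λ j j≢i → trans (*-congˡ (weight-indicator-≢ (j≢i ∘ b-injective))) (zeroʳ _))
        (trans (*-congˡ (weight-indicator-≡ (b i))) (*-identityʳ _))

      point-indicator-∉ : ∀ {k} (b : Fin k → Fin N) y i → (∀ j → b j ≢ i) → point A y (indicator A ∘ b) i ≈ 0#
      point-indicator-∉ b y i b≢i = sum-zero _ λ j → trans (*-congˡ (weight-indicator-≢ (b≢i j))) (zeroʳ _)

  module _ {A B : CommutativeRing c ℓ} (f : Hom A B) where
    open Ring B
    open Hom f

    select-homo : ∀ b x → ⟦ select A b x ⟧ ≈ select B b ⟦ x ⟧
    select-homo true  x = refl
    select-homo false x = trans (+-homo _ _) (+-cong 1-homo (-‿homo x))

    point-homo : ∀ {k} (y : Fin k → _) z i → ⟦ point A y z i ⟧ ≈ point B (⟦_⟧ ∘ y) (λ j → ⟦_⟧ ∘ z j) i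
    point-homo {k} y z i = trans (sum-homo (λ j → Ring._*_ A (y j) (weight A (z j) i)))
      (sum-cong-≋ {k} λ j → trans (*-homo (y j) (weight A (z j) i)) (*-congˡ
        (trans (product-homo (λ t → select A (code i t) (z j t))) (product-cong λ t → select-homo (code i t) (z j t)))))

    indicator-homo : ∀ i t → ⟦ indicator A i t ⟧ ≈ indicator B i t
    indicator-homo i t with code i t
    ... | true  = 1-homo
    ... | false = 0-homo

    perturb-homo : ∀ {k} (b : Fin k → Fin N) s ζ j t → ⟦ perturb A b s ζ j t ⟧ ≈ perturb B b ⟦ s ⟧ (λ j → ⟦_⟧ ∘ ζ j) j t
    perturb-homo b s ζ j t = trans (+-homo _ _) (+-cong (indicator-homo (b j) t) (*-homo _ _))

-- Vanishing at and near the points of the generator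

module Shifted (𝔽 : HeytingField c ℓ₁ ℓ₂) {N n : ℕ} (code : Fin N → Fin n → Bool)
               (code-injective : ∀ {i j} → (∀ t → code i t ≡ code j t) → i ≡ j)
               (F : Poly (fieldRing 𝔽) N) where
  open Field 𝔽
  open Rank 𝔽
  open Generator code

  VanishesOnPoints : ℕ → Set (lsuc (c ⊔ ℓ₁))
  VanishesOnPoints k = ∀ (B : CommutativeRing c ℓ₁) (ι : Hom K B) y z → let open Ring B in
    eval ι (point B {k} y z) F ≈ 0#

  -- The permutation encodes a support of size s: the perturbation x lives on the coordinates π 0, …, π (s - 1).
  VanishesNearPoints : ℕ → ℕ → Set (lsuc (c ⊔ ℓ₁))
  VanishesNearPoints m s = ∀ (π : Permutation′ N) (B : CommutativeRing c ℓ₁) (ι : Hom K B) y z (x : Fin N → Ring.Carrier B) → let open Ring B in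
    (∀ i → s ℕ.≤ toℕ i → x (π ⟨$⟩ʳ i) ≈ 0#) → eval ι (λ i → point B {m} y z i + x i) F ≈ 0#

  vanishesOnPoints-+ : ∀ k {r} → VanishesOnPoints (k ℕ.+ r) → VanishesOnPoints k
  vanishesOnPoints-+ k {r} vanishes B ι y z = trans
    (eval-congʳ ι (λ i → sym (restrict i)) F)
    (vanishes B ι (y ++ᶠ λ (_ : Fin r) → 0#) (z ++ᶠ λ _ _ → 0#))
    where
    open Ring B
    restrict : ∀ i → point B (y ++ᶠ λ (_ : Fin r) → 0#) (z ++ᶠ λ _ _ → 0#) i ≈ point B y z i
    restrict i = trans (sum-++ B k _) (trans (+-cong
      (sum-cong-≋ {k} λ j → reflexive (≡.cong₂ (λ yⱼ zⱼ → yⱼ * weight B zⱼ i) (lookup-++ˡ y _ j) (lookup-++ˡ z _ j)))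
      (sum-zero {r} _ λ j → trans (*-congʳ (reflexive (lookup-++ʳ y _ j))) (zeroˡ _)))
      (+-identityʳ _))

  onPoints⇒nearPoints : ∀ m s → s ℕ.≤ N → VanishesOnPoints (m ℕ.+ s) → VanishesNearPoints m s
  onPoints⇒nearPoints m s s≤N vanishes π B ι y z x x≈0 = trans
    (eval-congʳ ι (λ i → sym (add i)) F)
    (vanishes B ι (y ++ᶠ x ∘ b) (z ++ᶠ indicator B ∘ b))
    where
    open Ring B
    b : Fin s → Fin N
    b j = π ⟨$⟩ʳ inject≤ j s≤N
    b-injective : ∀ {i j} → b i ≡ b j → i ≡ j
    b-injective = Fin.inject≤-injective s≤N s≤N _ _ ∘ permutation-injective π
    supported : ∀ k → point B (x ∘ b) (indicator B ∘ b) (π ⟨$⟩ʳ k) ≈ x (π ⟨$⟩ʳ k)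
    supported k with toℕ k ℕ.<? s
    ... | yes k<s = ≡.subst (λ i → point B (x ∘ b) (indicator B ∘ b) i ≈ x i)
      (≡.cong (π ⟨$⟩ʳ_) (Fin.toℕ-injective (≡.trans (Fin.toℕ-inject≤ _ s≤N) (Fin.toℕ-fromℕ< k<s))))
      (point-indicator B code-injective b b-injective (x ∘ b) (fromℕ< k<s))
    ... | no  k≮s = trans
      (point-indicator-∉ B code-injective b (x ∘ b) _ λ j bⱼ≡ → k≮s (≡.subst (ℕ._< s)
        (≡.trans (≡.sym (Fin.toℕ-inject≤ j s≤N)) (≡.cong toℕ (permutation-injective π bⱼ≡))) (Fin.toℕ<n j)))
      (sym (x≈0 k (ℕ.≮⇒≥ k≮s)))
    add : ∀ i → point B (y ++ᶠ x ∘ b) (z ++ᶠ indicator B ∘ b) i ≈ point B y z i + x i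
    add i = trans (sum-++ B m _) (+-cong
      (sum-cong-≋ {m} λ j → reflexive (≡.cong₂ (λ yⱼ zⱼ → yⱼ * weight B zⱼ i) (lookup-++ˡ y _ j) (lookup-++ˡ z _ j)))
      (trans (sum-cong-≋ {s} λ j → reflexive (≡.cong₂ (λ yⱼ zⱼ → yⱼ * weight B zⱼ i) (lookup-++ʳ y _ j) (lookup-++ʳ z _ j)))
        (≡.subst (λ i → point B (x ∘ b) (indicator B ∘ b) i ≈ x i) (inverseʳ π) (supported (π ⟨$⟩ˡ i)))))

  -- With `s = N` the support condition is vacuous, so the perturbation may be the generic point,
  -- where `F` evaluates to itself.
  nearPoints⇒zero : ∀ m → VanishesNearPoints m N → ∀ e → let open Ring K in Coeff.coeff K F e ≈ 0#
  nearPoints⇒zero m vanishes e = begin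
    coeff F e                                           ≈⟨ coeff-eval-var (idHom K) F e ⟨
    coeff (eval ι var F) e                              ≈⟨ coeff≈ (eval-congʳ ι origin F) e ⟨
    coeff (eval ι (λ i → point (K [X N ]) {m} 0ʸ 0ᶻ i ++ var i) F) e ≈⟨ coeff≈ (vanishes Perm.id (K [X N ]) ι 0ʸ 0ᶻ var λ i N≤i → contradiction N≤i (ℕ.<⇒≱ (Fin.toℕ<n i))) e ⟩
    0#                                                  ∎
    where
    open Ring K
    open ≈-Reasoning
    open PolyRing K N
    module K[X] = Ring (K [X N ])
    ι = conHom K N ∘ʰ idHom K
    0ʸ : Fin m → K[X].Carrier
    0ʸ _ = K[X].0#
    0ᶻ : Fin m → Fin n → K[X].Carrier
    0ᶻ _ _ = K[X].0#
    origin : ∀ i → point (K [X N ]) 0ʸ 0ᶻ i K[X].+ var i K[X].≈ var i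
    origin i = K[X].trans (K[X].+-congʳ {var i} (K[X].sum-zero {m} _ λ j → K[X].zeroˡ (weight (K [X N ]) (0ᶻ j) i))) (K[X].+-identityˡ (var i))

-- Raising the support bound by one

module Step (𝔽 : HeytingField c ℓ₁ ℓ₂) {m q n w : ℕ} (code : Fin (m ℕ.+ q) → Fin n → Bool)
            (code-injective : ∀ {i j} → (∀ t → code i t ≡ code j t) → i ≡ j)
            (F : Poly (fieldRing 𝔽) (m ℕ.+ q)) (π : Permutation′ (m ℕ.+ q))
            (g : Fin w → Poly (fieldRing 𝔽) m) (h : Fin w → Poly (fieldRing 𝔽) q) where
  open Field 𝔽
  open Rank 𝔽
  open Generator code
  open Shifted 𝔽 code code-injective F

  -- The set `B` of the overview consists of the first `m` positions of `π`. Stating the identity at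
  -- points spares renaming the variables of `g` and `h` into those of `F`.
  Decomposition : Set (lsuc (c ⊔ ℓ₁))
  Decomposition = ∀ (B : CommutativeRing c ℓ₁) (ι : Hom K B) (x : Fin (m ℕ.+ q) → Ring.Carrier B) → let open Ring B in
    eval ι x F ≈ sum λ l → eval ι (x ∘ (π ⟨$⟩ʳ_) ∘ (_↑ˡ q)) (g l) * eval ι (x ∘ (π ⟨$⟩ʳ_) ∘ (m ↑ʳ_)) (h l)

  module _ (decomposition : Decomposition) (w<2^m : w ℕ.< 2 ℕ.^ m)
           (s : ℕ) (m≤1+s : m ℕ.≤ suc s) (s<N : s ℕ.< m ℕ.+ q) (near : VanishesNearPoints m s) where
    private
      -- After the `m` variables `Y` come the `m * n` variables `ζ` and the `q` coordinates of `x`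
      -- outside the first `m` positions; `Yᵛ`, `Zᵛ` and `Xᵛ` project to the three groups.
      r : ℕ
      r = m ℕ.* n ℕ.+ q

      left : Fin m → Fin (m ℕ.+ q)
      left j = π ⟨$⟩ʳ (j ↑ˡ q)

      right : Fin q → Fin (m ℕ.+ q)
      right k = π ⟨$⟩ʳ (m ↑ʳ k)

      Yᵛ : {C : Set c} → (Fin (m ℕ.+ r) → C) → Fin m → C
      Yᵛ v j = v (j ↑ˡ r)

      Zᵛ : {C : Set c} → (Fin (m ℕ.+ r) → C) → Fin m → Fin n → C
      Zᵛ v j t = v (m ↑ʳ (combine j t ↑ˡ q))

      Xᵛ : {C : Set c} → (Fin (m ℕ.+ r) → C) → Fin q → C
      Xᵛ v k = v (m ↑ʳ (m ℕ.* n ↑ʳ k))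

      module _ (B : CommutativeRing c ℓ₁) where
        open Ring B

        -- Builds the support condition into a vector of free variables: coordinates at positions
        -- after `s` are cut off.
        mask : Fin q → Carrier → Carrier
        mask k x = if does (suc s ℕ.≤? toℕ (m ↑ʳ k)) then 0# else x

        mask-beyond : ∀ k x → suc s ℕ.≤ toℕ (m ↑ʳ k) → mask k x ≡ 0#
        mask-beyond k x s<k = ≡.cong (if_then 0# else x) (dec-true (suc s ℕ.≤? toℕ (m ↑ʳ k)) s<k)

        mask-within : ∀ k x → ¬ (suc s ℕ.≤ toℕ (m ↑ʳ k)) → mask k x ≡ x
        mask-within k x s≮k = ≡.cong (if_then 0# else x) (dec-false (suc s ℕ.≤? toℕ (m ↑ʳ k)) s≮k)

        center : Carrier → (Fin (m ℕ.+ r) → Carrier) → Fin (m ℕ.+ q) → Carrier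
        center t v = point B (Yᵛ v) (perturb B left t (Zᵛ v))

        rest : Carrier → (Fin (m ℕ.+ r) → Carrier) → Fin q → Carrier
        rest t v k = center t v (right k) + mask k (Xᵛ v k)

        -- Since `m ≤ suc s`, the support contains the first `m` positions, so there the sum of
        -- center and perturbation is arbitrary. Its values are therefore the independent variables
        -- `u`, and the center enters only through `rest`.
        full : (Fin m → Carrier) → Carrier → (Fin (m ℕ.+ r) → Carrier) → Fin (m ℕ.+ q) → Carrier
        full u t v i = (u ++ᶠ rest t v) (π ⟨$⟩ˡ i)

      module _ {A B : CommutativeRing c ℓ₁} (f : Hom A B) where
        open Ring B
        open Hom f

        mask-homo : ∀ k x → ⟦ mask A k x ⟧ ≈ mask B k ⟦ x ⟧
        mask-homo k x with does (suc s ℕ.≤? toℕ (m ↑ʳ k))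
        ... | true  = 0-homo
        ... | false = refl

        center-homo : ∀ t v i → ⟦ center A t v i ⟧ ≈ center B ⟦ t ⟧ (⟦_⟧ ∘ v) i
        center-homo t v i = trans (point-homo f (Yᵛ v) (perturb A left t (Zᵛ v)) i)
          (point-cong B {m} i (λ _ → refl) λ j k → perturb-homo f left t (Zᵛ v) j k)

        rest-homo : ∀ t v k → ⟦ rest A t v k ⟧ ≈ rest B ⟦ t ⟧ (⟦_⟧ ∘ v) k
        rest-homo t v k = trans (+-homo _ _) (+-cong (center-homo t v (right k)) (mask-homo k (Xᵛ v k)))

      module _ (B : CommutativeRing c ℓ₁) where
        open Ring B

        center-cong : ∀ {t t′ v v′} i → t ≈ t′ → (∀ j → v j ≈ v′ j) → center B t v i ≈ center B t′ v′ i
        center-cong i t≈ v≈ = point-cong B {m} i (λ j → v≈ _) λ j k → +-congˡ (*-cong t≈ (v≈ _))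

        mask-cong : ∀ {x y} k → x ≈ y → mask B k x ≈ mask B k y
        mask-cong k x≈y with does (suc s ℕ.≤? toℕ (m ↑ʳ k))
        ... | true  = refl
        ... | false = x≈y

        rest-cong : ∀ {t t′ v v′} k → t ≈ t′ → (∀ j → v j ≈ v′ j) → rest B t v k ≈ rest B t′ v′ k
        rest-cong k t≈ v≈ = +-cong (center-cong (right k) t≈ v≈) (mask-cong k (v≈ _))

      -- The factor `h l` at the remaining coordinates, as a polynomial in `t`, `Y`, `ζ` and `x`.
      -- The scale `t` comes first so that `slice D` takes its coefficient at the `D`-th power of
      -- `t`.
      η : Fin w → Poly (fieldRing 𝔽) (suc (m ℕ.+ r))
      η l = compose (fieldRing 𝔽) (h l) (rest (K [X suc (m ℕ.+ r) ]) (Coeff.var K zero) (Coeff.var K ∘ suc))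

      module _ (B : CommutativeRing c ℓ₁) (ι : Hom K B) where
        open Ring B

        eval-η : ∀ t v l → eval ι (t ◂ v) (η l) ≈ eval ι (rest B t v) (h l)
        eval-η t v l = trans (eval-compose ι (h l) _ (t ◂ v)) (eval-congʳ ι (λ k →
          trans (rest-homo (evalHom ι (t ◂ v)) (Coeff.var K zero) (Coeff.var K ∘ suc) k)
            (rest-cong B k (eval-var ι (t ◂ v) zero) (λ j → eval-var ι (t ◂ v) (suc j)))) (h l))

        full-left : ∀ u t v j → full B u t v (left j) ≡ u j
        full-left u t v j = ≡.trans (≡.cong (u ++ᶠ rest B t v) (inverseˡ π)) (lookup-++ˡ u (rest B t v) j)

        full-right : ∀ u t v k → full B u t v (right k) ≡ rest B t v k
        full-right u t v k = ≡.trans (≡.cong (u ++ᶠ rest B t v) (inverseˡ π)) (lookup-++ʳ u (rest B t v) k)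

        eval-full : ∀ u t v → eval ι (full B u t v) F ≈ pairing g η B ι u (t ◂ v)
        eval-full u t v = trans (decomposition B ι (full B u t v)) (sum-cong-≋ {w} λ l → trans (*-comm _ _) (*-cong
          (trans (eval-congʳ ι (λ k → reflexive (full-right u t v k)) (h l)) (sym (eval-η t v l)))
          (eval-congʳ ι (λ j → reflexive (full-left u t v j)) (g l))))

        -- The offset from the center is zero after position `s` and, by the hypothesis on `u i`, at
        -- `left i`. This leaves `s` positions, and exchanging `i` with position `s` brings them to
        -- the front, as `near` requires.
        vanishes-at-center : ∀ i u t v → u i ≈ center B t v (left i) → pairing g η B ι u (t ◂ v) ≈ 0#
        vanishes-at-center i u t v uᵢ≈ = trans (sym (eval-full u t v)) (trans
          (eval-congʳ ι (λ j → sym (x+[y-x]≈y _ _)) F)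
          (near (transpose (i ↑ˡ q) sF ∘ₚ π) B ι (Yᵛ v) (perturb B left t (Zᵛ v)) offset offset≈0))
          where
          sF : Fin (m ℕ.+ q)
          sF = fromℕ< s<N
          offset : Fin (m ℕ.+ q) → Carrier
          offset j = full B u t v j + - center B t v j
          x+[y-x]≈y : ∀ x y → x + (y + - x) ≈ y
          x+[y-x]≈y x y = trans (+-congˡ (+-comm y (- x))) (trans (sym (+-assoc _ _ _)) (trans (+-congʳ (-‿inverseʳ x)) (+-identityˡ y)))
          offset-left : offset (left i) ≈ 0#
          offset-left = trans (+-congʳ (trans (reflexive (full-left u t v i)) uᵢ≈)) (-‿inverseʳ _)
          offset-right : ∀ k → suc s ℕ.≤ toℕ (m ↑ʳ k) → offset (right k) ≈ 0#
          offset-right k s<k = trans (+-congʳ (trans (reflexive (full-right u t v k)) (trans (+-congˡ (reflexive (mask-beyond B k _ s<k))) (+-identityʳ _)))) (-‿inverseʳ _)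
          offset-beyond : ∀ k → suc s ℕ.≤ toℕ k → offset (π ⟨$⟩ʳ k) ≈ 0#
          offset-beyond k s<k with splitAt m k in eq
          ... | inj₁ j  = contradiction (ℕ.≤-trans m≤1+s (≡.subst (suc s ℕ.≤_) (≡.trans (≡.cong toℕ (≡.sym (Fin.splitAt⁻¹-↑ˡ eq))) (Fin.toℕ-↑ˡ j q)) s<k)) (ℕ.<⇒≱ (Fin.toℕ<n j))
          ... | inj₂ k′ = ≡.subst (λ k → offset (π ⟨$⟩ʳ k) ≈ 0#) (Fin.splitAt⁻¹-↑ʳ eq)
            (offset-right k′ (≡.subst (λ k → suc s ℕ.≤ toℕ k) (≡.sym (Fin.splitAt⁻¹-↑ʳ eq)) s<k))
          offset≈0 : ∀ k → s ℕ.≤ toℕ k → offset ((transpose (i ↑ˡ q) sF ∘ₚ π) ⟨$⟩ʳ k) ≈ 0#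
          offset≈0 k s≤k with k Fin.≟ (i ↑ˡ q)
          -- Here `s ≤ i` and `i < m ≤ suc s`, so `i` is position `s` and the exchange does nothing.
          ... | yes ≡.refl = ≡.subst (λ j → offset (π ⟨$⟩ʳ j) ≈ 0#) (Fin.toℕ-injective (≡.trans i≡s (≡.sym (Fin.toℕ-fromℕ< s<N)))) offset-left
            where
            i≡s : toℕ (i ↑ˡ q) ≡ s
            i≡s = ℕ.≤-antisym (ℕ.≤-pred (ℕ.≤-trans (ℕ.≤-reflexive (≡.cong suc (Fin.toℕ-↑ˡ i q))) (ℕ.≤-trans (Fin.toℕ<n i) m≤1+s))) s≤k
          ... | no _ with k Fin.≟ sF
          ...   | yes _    = offset-left
          ...   | no  k≢sF = offset-beyond k (ℕ.≤∧≢⇒< s≤k λ s≡k → k≢sF (Fin.toℕ-injective (≡.trans (≡.sym s≡k) (≡.sym (Fin.toℕ-fromℕ< s<N)))))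

      -- The i-th coordinate of center is Y_i up to multiples of t, so the lowest nonzero coefficient in t of a
      -- polynomial vanishing at U_i = center_i vanishes at U_i = Y_i.
      slices-vanish-on-diagonals : ∀ D → (∀ {D′} → D′ ℕ.< D → ∀ a b → let open Ring K in tensor g (slice D′ ∘ η) a b ≈ 0#) →
        VanishesOnDiagonals m r g (slice D ∘ η)
      slices-vanish-on-diagonals D below i B ι u v uᵢ≈vᵢ = begin
        sum (λ l → eval ι v (slice D (η l)) * eval ι u (g l))
          ≈⟨ sum-cong-≋ {w} (λ l → *-congˡ (constant l)) ⟨
        sum (λ l → eval ι v (slice D (η l)) * coeff₁ {A = B} (ĝ l) 0)
          ≈⟨ +-identityʳ _ ⟨
        sum (λ l → term zero l) + 0#
          -- A positive power of `t` from `ĝ` meets a slice of `η` of index below `D`. The tensor of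
          -- that slice is zero by `below`, so its pairing is zero even at the point `û` over
          -- `B [X 1 ]`.
          ≈⟨ +-congˡ (sum-zero {D} (λ x → sum (λ l → term (suc x) l)) higher) ⟨
        sum {suc D} (λ x → sum (λ l → term x l))
          ≈⟨ ∑-comm term ⟩
        sum (λ l → sum {suc D} (λ x → term x l))
          ≈⟨ sum-cong-≋ {w} (λ l → sum-cong-≋ {suc D} λ x → *-congʳ {coeff₁ {A = B} (ĝ l) (toℕ x)} (eval-slice ι v (η l) (D ∸ toℕ x))) ⟨
        sum (λ l → sum {suc D} (λ x → coeff₁ {A = B} (η̂ l) (D ∸ toℕ x) * coeff₁ {A = B} (ĝ l) (toℕ x)))
          ≈⟨ sum-cong-≋ {w} (λ l → coeff₁-* {A = B} (η̂ l) (ĝ l) D) ⟨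
        sum (λ l → coeff₁ {A = B} (η̂ l *ₚ ĝ l) D)
          ≈⟨ coeff-sum {A = B} (λ l → η̂ l *ₚ ĝ l) (D ∷ []) ⟨
        coeff₁ {A = B} (B[X].sum (λ l → η̂ l *ₚ ĝ l)) D
          ≈⟨ coeff≈ (vanishes-at-center (B [X 1 ]) ι̂ i û τ v̂ (B[X].reflexive û-i)) (D ∷ []) ⟩
        0# ∎
        where
        open Ring B
        open ≈-Reasoning
        open PolyRing B 1
        module B[X] = Ring (B [X 1 ])
        ι̂ : Hom K (B [X 1 ])
        ι̂ = conHom B 1 ∘ʰ ι
        τ : B[X].Carrier
        τ = var zero
        v̂ : Fin (m ℕ.+ r) → B[X].Carrier
        v̂ = con ∘ v
        -- Only coordinate `i` is moved, onto the center, where the pairing is known to vanish. At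
        -- `t = 0` it is `u i` again, by `constant-center`.
        û : Fin m → B[X].Carrier
        û j = if does (j Fin.≟ i) then center (B [X 1 ]) τ v̂ (left i) else con (u j)
        û-i : û i ≡ center (B [X 1 ]) τ v̂ (left i)
        û-i with i Fin.≟ i
        ... | yes _   = ≡.refl
        ... | no  i≢i = contradiction ≡.refl i≢i
        η̂ ĝ : Fin w → B[X].Carrier
        η̂ l = eval ι̂ (τ ◂ v̂) (η l)
        ĝ l = eval ι̂ û (g l)
        term : Fin (suc D) → Fin w → Carrier
        term x l = eval ι v (slice (D ∸ toℕ x) (η l)) * coeff₁ {A = B} (ĝ l) (toℕ x)
        constant-center : coeff₁ {A = B} (center (B [X 1 ]) τ v̂ (left i)) 0 ≈ u i
        constant-center = begin
          coeff₁ {A = B} (center (B [X 1 ]) τ v̂ (left i)) 0           ≈⟨ center-homo (constantTerm {A = B}) τ v̂ (left i) ⟩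
          center B (coeff₁ {A = B} τ 0) (λ j → coeff₁ {A = B} (v̂ j) 0) (left i) ≈⟨ center-cong B (left i) refl (λ j → coeff-con-0 {A = B} {1} (v j)) ⟩
          center B 0# v (left i)                                      ≈⟨ point-cong B {m} (left i) (λ _ → refl) (λ j k → trans (+-congˡ (zeroˡ _)) (+-identityʳ _)) ⟩
          point B (Yᵛ v) (indicator B ∘ left) (left i)                ≈⟨ point-indicator B code-injective left (Fin.↑ˡ-injective q _ _ ∘ permutation-injective π) (Yᵛ v) i ⟩
          v (i ↑ˡ r)                                                  ≈⟨ uᵢ≈vᵢ ⟨
          u i                                                         ∎
        constant-û : ∀ j → coeff₁ {A = B} (û j) 0 ≈ u j
        constant-û j with j Fin.≟ i
        ... | yes ≡.refl = constant-center
        ... | no  _      = coeff-con-0 {A = B} {1} (u j)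
        constant : ∀ l → coeff₁ {A = B} (ĝ l) 0 ≈ eval ι u (g l)
        constant l = trans (eval-natural ι̂ (constantTerm {A = B}) û (g l))
          (trans (eval-congʳ (constantTerm {A = B} ∘ʰ ι̂) constant-û (g l))
            (eval-congˡ (constantTerm {A = B} ∘ʰ ι̂) ι (λ a → coeff-con-0 {A = B} {1} (Hom.⟦_⟧ ι a)) u (g l)))
        higher : ∀ x → sum (λ l → term (suc x) l) ≈ 0#
        higher x = begin
          sum (λ l → eval ι v (slice D′ (η l)) * coeff₁ {A = B} (ĝ l) (suc (toℕ x)))
            ≈⟨ sum-cong-≋ {w} (λ l → coeff-con-* {A = B} (eval ι v (slice D′ (η l))) (ĝ l) (suc (toℕ x) ∷ [])) ⟨
          sum (λ l → coeff₁ {A = B} (con (eval ι v (slice D′ (η l))) *ₚ ĝ l) (suc (toℕ x)))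
            ≈⟨ coeff-sum {A = B} (λ l → con (eval ι v (slice D′ (η l))) *ₚ ĝ l) (suc (toℕ x) ∷ []) ⟨
          coeff₁ {A = B} (B[X].sum (λ l → con (eval ι v (slice D′ (η l))) *ₚ ĝ l)) (suc (toℕ x))
            ≈⟨ coeff≈ (B[X].sum-cong-≋ {w} (λ l → B[X].*-congʳ {ĝ l} (eval-natural ι (conHom B 1) v (slice D′ (η l))))) (suc (toℕ x) ∷ []) ⟩
          coeff₁ {A = B} (pairing g (slice D′ ∘ η) (B [X 1 ]) ι̂ û v̂) (suc (toℕ x))
            ≈⟨ coeff≈ (tensor≈0⇒pairing≈0 g (slice D′ ∘ η) (below D′<D) (B [X 1 ]) ι̂ û v̂) (suc (toℕ x) ∷ []) ⟩
          0# ∎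
          where
          D′ = D ∸ suc (toℕ x)
          D′<D : D′ ℕ.< D
          D′<D = ℕ.∸-monoʳ-< {o = 0} (ℕ.s≤s ℕ.z≤n) (Fin.toℕ<n x)

      slices≈0 : ∀ D a b → let open Ring K in tensor g (slice D ∘ η) a b ≈ 0#
      slices≈0 = <-rec _ λ D below → tensor-rank m r g (slice D ∘ η) w<2^m (slices-vanish-on-diagonals D below)

      pairing-η≈0 : ∀ B ι u v → let open Ring B in pairing g η B ι u v ≈ 0#
      pairing-η≈0 = tensor≈0⇒pairing≈0 g η λ { a (D ∷ b) → trans
        (sum-cong-≋ {w} λ l → *-congʳ (sym (coeff-slice {A = K} D (η l) b))) (slices≈0 D a b) }
        where open Ring K

    -- All powers of `t` have been dealt with, so `t` may be `1#`. Taking `ζ` to be `z` minus the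
    -- indicators turns the perturbed values into the given `z`, and `u` is read off from the point
    -- itself.
    vanishes-one-further : ∀ B (ι : Hom K B) y z x → let open Ring B in
      (∀ i → suc s ℕ.≤ toℕ i → x (π ⟨$⟩ʳ i) ≈ 0#) → eval ι (λ i → point B {m} y z i + x i) F ≈ 0#
    vanishes-one-further B ι y z x x≈0 = trans (eval-congʳ ι (λ i →
        ≡.subst (λ i → target i ≈ full B u 1# v i) (inverseʳ π) (agree (π ⟨$⟩ˡ i))) F)
      (trans (eval-full B ι u 1# v) (pairing-η≈0 B ι u (1# ◂ v)))
      where
      open Ring B
      target : Fin (m ℕ.+ q) → Carrier
      target i = point B y z i + x i
      u : Fin m → Carrier
      u = target ∘ left
      ζ : Fin m → Fin n → Carrier
      ζ j t = z j t + - indicator B (left j) t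
      tail : Fin r → Carrier
      tail = (uncurry ζ ∘ remQuot n) ++ᶠ (x ∘ right)
      v : Fin (m ℕ.+ r) → Carrier
      v = y ++ᶠ tail
      v-Y : ∀ j → Yᵛ v j ≡ y j
      v-Y = lookup-++ˡ y tail
      v-Z : ∀ j t → Zᵛ v j t ≡ ζ j t
      v-Z j t = ≡.trans (lookup-++ʳ y tail _) (≡.trans (lookup-++ˡ (uncurry ζ ∘ remQuot n) (x ∘ right) (combine j t))
        (≡.cong (uncurry ζ) (Fin.remQuot-combine j t)))
      v-X : ∀ k → Xᵛ v k ≡ x (right k)
      v-X k = ≡.trans (lookup-++ʳ y tail _) (lookup-++ʳ (uncurry ζ ∘ remQuot n) (x ∘ right) k)
      center≈ : ∀ i → center B 1# v i ≈ point B y z i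
      center≈ i = point-cong B {m} i (λ j → reflexive (v-Y j)) λ j t →
        trans (+-congˡ (trans (*-identityˡ _) (trans (reflexive (v-Z j t)) (+-comm _ _))))
          (trans (sym (+-assoc _ _ _)) (trans (+-congʳ (-‿inverseʳ _)) (+-identityˡ _)))
      mask≈ : ∀ k → mask B k (Xᵛ v k) ≈ x (right k)
      mask≈ k with suc s ℕ.≤? toℕ (m ↑ʳ k)
      ... | yes s<k = trans (reflexive (mask-beyond B k (Xᵛ v k) s<k)) (sym (x≈0 (m ↑ʳ k) s<k))
      ... | no  s≮k = reflexive (≡.trans (mask-within B k (Xᵛ v k) s≮k) (v-X k))
      agree : ∀ i → target (π ⟨$⟩ʳ i) ≈ full B u 1# v (π ⟨$⟩ʳ i)
      agree i with splitAt m i in eq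
      ... | inj₁ j = ≡.subst (λ i → target (π ⟨$⟩ʳ i) ≈ full B u 1# v (π ⟨$⟩ʳ i)) (Fin.splitAt⁻¹-↑ˡ eq)
        (sym (reflexive (full-left B ι u 1# v j)))
      ... | inj₂ k = ≡.subst (λ i → target (π ⟨$⟩ʳ i) ≈ full B u 1# v (π ⟨$⟩ʳ i)) (Fin.splitAt⁻¹-↑ʳ eq)
        (sym (trans (reflexive (full-right B ι u 1# v k)) (+-cong (center≈ (right k)) (mask≈ k))))

-- Read-once oblivious algebraic branching programs

module _ (B : CommutativeRing c ℓ) (w : ℕ) where
  open Ring B
  open ≈-Reasoning
  open Matrices rawRing w

  identity-⊗ : ∀ (M : Matrix) a b → (identity ⊗ M) a b ≈ M a b
  identity-⊗ M a b = trans
    (sum-single B _ a λ l l≢a → trans (*-congʳ (reflexive (≡.cong (if_then 1# else 0#) (dec-false (a Fin.≟ l) (l≢a ∘ ≡.sym))))) (zeroˡ _))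
    (trans (*-congʳ (reflexive (≡.cong (if_then 1# else 0#) (dec-true (a Fin.≟ a) ≡.refl)))) (*-identityˡ _))

  matrixProduct-++ : ∀ m {q} (M : Fin (m ℕ.+ q) → Matrix) a b →
    matrixProduct M a b ≈ (matrixProduct (M ∘ (_↑ˡ q)) ⊗ matrixProduct (M ∘ (m ↑ʳ_))) a b
  matrixProduct-++ zero        M a b = sym (identity-⊗ (matrixProduct M) a b)
  matrixProduct-++ (suc m) {q} M a b = begin
    sum (λ k → M zero a k * matrixProduct (M ∘ suc) k b)        ≈⟨ sum-cong-≋ {w} (λ k → *-congˡ (matrixProduct-++ m (M ∘ suc) k b)) ⟩
    sum (λ k → M zero a k * sum (λ l → P k l * Q l b))          ≈⟨ sum-cong-≋ {w} (λ k → *-distribˡ-sum (M zero a k) (λ l → P k l * Q l b)) ⟩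
    sum (λ k → sum (λ l → M zero a k * (P k l * Q l b)))        ≈⟨ ∑-comm (λ k l → M zero a k * (P k l * Q l b)) ⟩
    sum (λ l → sum (λ k → M zero a k * (P k l * Q l b)))        ≈⟨ sum-cong-≋ {w} (λ l → sum-cong-≋ {w} (λ k → *-assoc (M zero a k) (P k l) (Q l b))) ⟨
    sum (λ l → sum (λ k → M zero a k * P k l * Q l b))          ≈⟨ sum-cong-≋ {w} (λ l → *-distribʳ-sum (Q l b) (λ k → M zero a k * P k l)) ⟨
    sum (λ l → sum (λ k → M zero a k * P k l) * Q l b)          ∎
    where
    P = matrixProduct (M ∘ suc ∘ (_↑ˡ q))
    Q = matrixProduct (M ∘ (suc m ↑ʳ_))

module _ {A : CommutativeRing c ℓ} {w : ℕ} where
  private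
    R = CommutativeRing.rawRing A

  -- The relabelling `s` covers both the whole program, with `s` its variable order, and the two
  -- halves in variables of their own, with `s = id`.
  layers : ∀ {N N′} → (Fin N → Fin w → Fin w → Poly R 1) → (Fin N → Fin N′) → Fin N → Fin w → Fin w → Poly R N′
  layers M s i a b = compose R (M i a b) (λ _ → Coeff.var A (s i))

  eval-matrixProduct : ∀ {B : CommutativeRing c ℓ} (ι : Hom A B) {N N′} M (s : Fin N → Fin N′) x a b → let open Ring B in
    eval ι x (Matrices.matrixProduct (polyRing R N′) w (layers M s) a b)
      ≈ Matrices.matrixProduct (CommutativeRing.rawRing B) w (λ i a b → eval ι (λ _ → x (s i)) (M i a b)) a b
  eval-matrixProduct {B} ι {zero}       M s x a b with does (a Fin.≟ b)
  ... | true  = Hom.1-homo (evalHom ι x)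
  ... | false = Hom.0-homo (evalHom ι x)
  eval-matrixProduct {B} ι {suc N} {N′} M s x a b = trans
    (sum-homo (λ l → layers M s zero a l A[X].* rest l b))
    (sum-cong-≋ {w} λ l → trans (*-homo (layers M s zero a l) (rest l b)) (*-cong
      (trans (eval-compose ι (M zero a l) (λ _ → Coeff.var A (s zero)) x) (eval-congʳ ι (λ _ → eval-var ι x (s zero)) (M zero a l)))
      (eval-matrixProduct ι (M ∘ suc) (s ∘ suc) x l b)))
    where
    open Ring B
    open Hom (evalHom ι x)
    module A[X] = Ring (A [X N′ ])
    rest = Matrices.matrixProduct (polyRing R N′) w (layers (M ∘ suc) (s ∘ suc))

module _ (𝔽 : HeytingField c ℓ₁ ℓ₂) {m q n : ℕ} (code : Fin (m ℕ.+ q) → Fin n → Bool)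
         (code-injective : ∀ {i j} → (∀ t → code i t ≡ code j t) → i ≡ j)
         (F : Poly (fieldRing 𝔽) (m ℕ.+ q)) (w : ℕ) .{{_ : NonZero w}} where
  open Field 𝔽

  -- The program is cut after `m` layers. The summation index is the state at the cut, which is why
  -- the width bounds the number of summands.
  roABP-decomposition : ∀ σ → ROABP.ComputedByROABP (fieldRing 𝔽) w σ F →
    ∃[ g ] ∃[ h ] Step.Decomposition 𝔽 {w = w} code code-injective F σ g h
  roABP-decomposition σ (M , F≈) =
      (λ l → Matrices.matrixProduct (polyRing (fieldRing 𝔽) m) w (layers {A = K} (M ∘ (_↑ˡ q)) id) first l)
    , (λ l → Matrices.matrixProduct (polyRing (fieldRing 𝔽) q) w (layers {A = K} (M ∘ (m ↑ʳ_)) id) l first)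
    , λ B ι x → let open Ring B in
        trans (Hom.⟦⟧-cong (evalHom ι x) {F} {ROABP.roABP (fieldRing 𝔽) w σ M} (PolyRing.mk≋ F≈))
          (trans (eval-matrixProduct {A = K} ι M (σ ⟨$⟩ʳ_) x first first)
            (trans (matrixProduct-++ B w m _ first first)
              (sum-cong-≋ {w} λ l → sym (*-cong
                (eval-matrixProduct {A = K} ι (M ∘ (_↑ˡ q)) id (x ∘ (σ ⟨$⟩ʳ_) ∘ (_↑ˡ q)) first l)
                (eval-matrixProduct {A = K} ι (M ∘ (m ↑ʳ_)) id (x ∘ (σ ⟨$⟩ʳ_) ∘ (m ↑ʳ_)) l first)))))
    where first = ROABP.first (fieldRing 𝔽) w {m ℕ.+ q}

-- The generator

module _ (A : CommutativeRing c ℓ) where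
  open Ring A

  private
    -- The shifted `p` is free of the first variable, so the power `bit s` comes from the linear
    -- factor: from `a` if it is one, from `b` if it is zero.
    coeff-factor : ∀ {n} a b (p : Poly rawRing n) s e → let open PolyRing A (suc n) in
      coeff ((con a *ₚ var zero ++ con b) *ₚ shift {A = A} p) (bit s ∷ e) ≈ (if s then a else b) * Coeff.coeff A p e
    coeff-factor {n} a b p s e = begin
      coeff (f *ₚ shift {A = A} p) (bit s ∷ e)                                      ≈⟨ coeff≈lin (f *ₚ shift {A = A} p) (bit s ∷ e) ⟩
      lin (f *ₚ shift {A = A} p) (δ (bit s ∷ e))                                    ≈⟨ lin-* f (shift {A = A} p) (δ (bit s ∷ e)) ⟩
      (a * 1#) * lin (shift {A = A} p) (λ e′ → δ (bit s ∷ e) (e₁ ⊕ e′)) + (b * lin (shift {A = A} p) (λ e′ → δ (bit s ∷ e) (replicate (suc n) 0 ⊕ e′)) + 0#)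
        ≈⟨ +-cong (*-cong (*-identityʳ a) (lin-shift {A = A} p _)) (trans (+-identityʳ _) (*-congˡ (lin-shift {A = A} p _))) ⟩
      a * L.lin p (λ e′ → δ (bit s ∷ e) (1 ∷ (zeros ⊕ zeros ⊕ e′))) + b * L.lin p (λ e′ → δ (bit s ∷ e) (0 ∷ (zeros ⊕ e′)))
        ≈⟨ +-cong (*-congˡ (L.lin-congʳ p λ e′ → reflexive (≡.cong (λ v → δ (bit s ∷ e) (1 ∷ v)) (≡.trans (≡.cong (_⊕ e′) (0⊕ zeros)) (0⊕ e′)))))
             (*-congˡ (L.lin-congʳ p λ e′ → reflexive (≡.cong (λ v → δ (bit s ∷ e) (0 ∷ v)) (0⊕ e′)))) ⟩
      a * L.lin p (λ e′ → δ (bit s ∷ e) (1 ∷ e′)) + b * L.lin p (λ e′ → δ (bit s ∷ e) (0 ∷ e′))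
        ≈⟨ choose s ⟩
      (if s then a else b) * Coeff.coeff A p e                                      ∎
      where
      open ≈-Reasoning
      open PolyRing A (suc n)
      open Linear (idHom A) {suc n}
      module L = Linear (idHom A) {n}
      f : Poly rawRing (suc n)
      f = con a *ₚ var zero ++ con b
      zeros = replicate n 0
      e₁ = 1 ∷ (zeros ⊕ zeros)
      0⊕ : ∀ e′ → zeros ⊕ e′ ≡ e′
      0⊕ = Vec.zipWith-identityˡ (λ _ → ≡.refl)
      choose : ∀ s → a * L.lin p (λ e′ → δ (bit s ∷ e) (1 ∷ e′)) + b * L.lin p (λ e′ → δ (bit s ∷ e) (0 ∷ e′)) ≈ (if s then a else b) * Coeff.coeff A p e
      choose true  = trans (+-cong (*-congˡ (sym (PolyRing.coeff≈lin A n p e))) (trans (*-congˡ (L.lin-0ʳ p)) (zeroʳ b))) (+-identityʳ _)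
      choose false = trans (+-cong (trans (*-congˡ (L.lin-0ʳ p)) (zeroʳ a)) (*-congˡ (sym (PolyRing.coeff≈lin A n p e)))) (+-identityˡ _)

  coeff-product : ∀ {n} (a b : Fin n → Carrier) (S : Vec Bool n) → let open PolyRing A n in
    coeff (Ring.product (A [X n ]) (λ i → con (a i) *ₚ var i ++ con (b i))) (Vec.map bit S)
      ≈ product (λ i → if lookup S i then a i else b i)
  coeff-product         a b []      = trans (Coeff.coeff-here A 1# [] []) (+-identityʳ 1#)
  coeff-product {suc n} a b (s ∷ S) = begin
    coeff (f zero *ₚ A[X].product (f ∘ suc)) (Vec.map bit (s ∷ S))     ≈⟨ coeff≈ (A[X].*-congˡ {f zero} (Hom.product-homo (shiftHom {A = A} {n}) f′)) (Vec.map bit (s ∷ S)) ⟨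
    coeff (f zero *ₚ shift {A = A} p) (bit s ∷ Vec.map bit S)          ≈⟨ coeff-factor (a zero) (b zero) p s (Vec.map bit S) ⟩
    (if s then a zero else b zero) * Coeff.coeff A p (Vec.map bit S)   ≈⟨ *-congˡ (coeff-product (a ∘ suc) (b ∘ suc) S) ⟩
    (if s then a zero else b zero) * product (λ i → if lookup S i then a (suc i) else b (suc i)) ∎
    where
    open ≈-Reasoning
    open PolyRing A (suc n)
    module A[X] = Ring (A [X suc n ])
    f : Fin (suc n) → A[X].Carrier
    f i = con (a i) *ₚ var i ++ con (b i)
    f′ : Fin n → Poly rawRing n
    f′ i = Coeff.con A (a (suc i)) *ₚ′ Coeff.var A i ++ Coeff.con A (b (suc i))
      where open Coeff A {n} using () renaming (_*ₚ_ to _*ₚ′_)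
    p = Ring.product (A [X n ]) f′

module _ (K : CommutativeRing c ℓ) (n k : ℕ) where
  open CommutativeRing K using (rawRing)
  open SSV rawRing n k
  open Generator (lookup ∘ subsetAt n)
  private
    A : CommutativeRing c ℓ
    A = K [X #yz ]
    module A = Ring A
    module A[X] = Ring (A [X n ])
    open PolyRing A n using (coeff; con; var; _*ₚ_)

    -- `R[y,z]` and `A` share their operations but not their equality relation, so the two
    -- coefficient functions are taken over different raw rings.
    coeff≡coeff : ∀ (p : Poly R[y,z] n) e → Polynomial.coeff R[y,z] n p e ≡ coeff p e
    coeff≡coeff []             e = ≡.refl
    coeff≡coeff ((a , e′) ∷ p) e with does (Vec.≡-dec ℕ._≟_ e′ e)
    ... | true  = ≡.cong (a A.+_) (coeff≡coeff p e)
    ... | false = coeff≡coeff p e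

  𝒢≈point : ∀ i → 𝒢 i A.≈ point A y z i
  𝒢≈point i = begin
    𝒢 i                                           ≡⟨ coeff≡coeff Q S ⟩
    coeff (A[X].sum (λ j → con (y j) *ₚ P (z j))) S ≈⟨ coeff-sum {A = A} (λ j → con (y j) *ₚ P (z j)) S ⟩
    A.sum (λ j → coeff (con (y j) *ₚ P (z j)) S)    ≈⟨ A.sum-cong-≋ {k} (λ j → A.trans (coeff-con-* {A = A} (y j) (P (z j)) S)
      (A.*-congˡ {y j} (coeff-product A (z j) (λ t → A.1# A.+ A.- z j t) (subsetAt n i)))) ⟩
    point A y z i                                 ∎
    where
    open A.≈-Reasoning
    S = Vec.map bit (subsetAt n i)

  eval-𝒢 : ∀ {B : CommutativeRing c ℓ} (ι : Hom K B) υ ζ i → let open Ring B in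
    eval ι (υ ++ᶠ (uncurry ζ ∘ remQuot n)) (𝒢 i) ≈ point B υ ζ i
  eval-𝒢 {B} ι υ ζ i = begin
    eval ι ρ (𝒢 i)                                        ≈⟨ Hom.⟦⟧-cong (evalHom ι ρ) (𝒢≈point i) ⟩
    eval ι ρ (point A y z i)                              ≈⟨ point-homo (evalHom ι ρ) y z i ⟩
    point B (eval ι ρ ∘ y) (λ j → eval ι ρ ∘ z j) i       ≈⟨ point-cong B {k} i (λ j → trans (eval-var ι ρ _) (reflexive (lookup-++ˡ υ _ j)))
      (λ j t → trans (eval-var ι ρ _) (reflexive (≡.trans (lookup-++ʳ υ _ (combine j t)) (≡.cong (uncurry ζ) (Fin.remQuot-combine j t))))) ⟩
    point B υ ζ i                                         ∎
    where
    open Ring B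
    open ≈-Reasoning
    ρ = υ ++ᶠ (uncurry ζ ∘ remQuot n)

-- Binary logarithms and the induction on the support size

open import Data.Nat.Base using (_+_; _*_; _^_; _≤_; _<_; z≤n; s≤s; ⌈_/2⌉; ⌊_/2⌋)

n≤2^⌈log₂n⌉ : ∀ n → n ≤ 2 ^ ⌈log₂ n ⌉
n≤2^⌈log₂n⌉ = <-rec _ step
  where
  step : ∀ n → (∀ {k} → k < n → k ≤ 2 ^ ⌈log₂ k ⌉) → n ≤ 2 ^ ⌈log₂ n ⌉
  step zero          _   = z≤n
  step (suc zero)    _   = ℕ.m^n>0 2 ⌈log₂ 1 ⌉
  step (suc (suc n)) rec = begin
    k                              ≡⟨ ℕ.⌊n/2⌋+⌈n/2⌉≡n k ⟨
    ⌊ k /2⌋ + ⌈ k /2⌉              ≤⟨ ℕ.+-monoˡ-≤ ⌈ k /2⌉ (ℕ.⌊n/2⌋≤⌈n/2⌉ k) ⟩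
    ⌈ k /2⌉ + ⌈ k /2⌉              ≡⟨ ≡.cong (⌈ k /2⌉ +_) (ℕ.+-identityʳ ⌈ k /2⌉) ⟨
    2 * ⌈ k /2⌉                    ≤⟨ ℕ.*-monoʳ-≤ 2 (rec (ℕ.⌈n/2⌉<n n)) ⟩
    2 * 2 ^ ⌈log₂ ⌈ k /2⌉ ⌉        ≡⟨ ≡.cong (λ e → 2 * 2 ^ e) (⌈log₂⌈n/2⌉⌉≡⌈log₂n⌉∸1 k) ⟩
    -- The subtraction is not truncated, since `k` is at least two.
    2 ^ (1 + (⌈log₂ k ⌉ ∸ 1))      ≡⟨ ≡.cong (2 ^_) (ℕ.m+[n∸m]≡n 1≤log) ⟩
    2 ^ ⌈log₂ k ⌉                  ∎
    where
    open ℕ.≤-Reasoning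
    k = suc (suc n)
    1≤log : 1 ≤ ⌈log₂ k ⌉
    1≤log = ≡.subst (_≤ ⌈log₂ k ⌉) (⌈log₂2^n⌉≡n 1) (⌈log₂⌉-mono-≤ {2} {k} (s≤s (s≤s z≤n)))

subsetAt-injective : ∀ n {i j : Fin (2 ^ n)} → (∀ t → lookup (subsetAt n i) t ≡ lookup (subsetAt n j) t) → i ≡ j
subsetAt-injective n {i} {j} eq = Fin.toℕ-injective (begin
  toℕ i                ≡⟨ subsetAt-index n i ⟨
  index (subsetAt n i) ≡⟨ ≡.cong index (≡.trans (≡.sym (Vec.tabulate∘lookup (subsetAt n i))) (≡.trans (Vec.tabulate-cong eq) (Vec.tabulate∘lookup (subsetAt n j)))) ⟩
  index (subsetAt n j) ≡⟨ subsetAt-index n j ⟩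
  toℕ j                ∎)
  where open ≡.≡-Reasoning

module _ (𝔽 : HeytingField c ℓ₁ ℓ₂) (w : ℕ) .{{_ : NonZero w}} where
  open Field 𝔽

  -- `N` and `code` are variables here and in the modules above, because the equation that splits
  -- `N` could not be matched for `2 ^ n`.
  nearPoints-suc : ∀ {N n} m q → N ≡ m + q → (code : Fin N → Fin n → Bool)
    (code-injective : ∀ {i j} → (∀ t → code i t ≡ code j t) → i ≡ j) (F : Poly (fieldRing 𝔽) N) →
    ComputedByCommutativeROABP (fieldRing 𝔽) w F → w < 2 ^ m → ∀ s → m ≤ suc s → s < N →
    let open Shifted 𝔽 code code-injective F in VanishesNearPoints m s → VanishesNearPoints m (suc s)
  nearPoints-suc m q ≡.refl code code-injective F computed w<2^m s m≤1+s s<N near π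
    -- The order `π` comes from the support of the perturbation, which is arbitrary. This is where
    -- programs in all orders are called for.
    with roABP-decomposition 𝔽 {m} {q} code code-injective F w π (computed π)
  ... | g , h , decomposition =
    Step.vanishes-one-further 𝔽 {m} {q} code code-injective F π g h decomposition w<2^m s m≤1+s s<N near

  module _ (n : ℕ) (F : Poly (fieldRing 𝔽) (2 ^ n)) (computed : ComputedByCommutativeROABP (fieldRing 𝔽) w F) where
    private
      N l m : ℕ
      N = 2 ^ n
      l = ⌈log₂ w ⌉
      m = suc l

      open Shifted 𝔽 (lookup ∘ subsetAt n) (subsetAt-injective n) F

      w<2^m : w < 2 ^ m
      w<2^m = ℕ.≤-<-trans (n≤2^⌈log₂n⌉ w) (ℕ.^-monoʳ-< 2 (s≤s (s≤s z≤n)) (ℕ.n<1+n l))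

      -- The center takes `m` summands and the perturbation `s` more, together at most `1 + 2 * l`.
      m+s≤k : ∀ {s} → s ≤ l → m + s ≤ 1 + 4 * l
      m+s≤k s≤l = s≤s (ℕ.+-monoʳ-≤ l (ℕ.≤-trans s≤l (ℕ.m≤m+n l _)))

      -- Supports of size at most `l` are realised by further summands of the generator. A larger
      -- support has at least `m` positions, so the step applies; then also `m ≤ N`, and `N ∸ m` is
      -- a true difference.
      near : VanishesOnPoints (1 + 4 * l) → ∀ s → s ≤ N → VanishesNearPoints m s
      near vanishes s s≤N with s ℕ.≤? l
      ... | yes s≤l = onPoints⇒nearPoints m s s≤N
        (vanishesOnPoints-+ (m + s) (≡.subst VanishesOnPoints (≡.sym (ℕ.m+[n∸m]≡n (m+s≤k s≤l))) vanishes))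
      near vanishes zero    s≤N | no s≰l = contradiction z≤n s≰l
      near vanishes (suc s) s≤N | no s≰l = nearPoints-suc m (N ∸ m) (≡.sym (ℕ.m+[n∸m]≡n (ℕ.≤-trans (ℕ.≰⇒> s≰l) s≤N)))
        (lookup ∘ subsetAt n) (subsetAt-injective n) F computed w<2^m s (ℕ.≰⇒> s≰l) s≤N (near vanishes s (ℕ.<⇒≤ s≤N))

    hitting : let k = 1 + 4 * l in
      Polynomial._≈ₚ_ (fieldRing 𝔽) (SSV.#yz (fieldRing 𝔽) n k) (compose (fieldRing 𝔽) F (SSV.𝒢 (fieldRing 𝔽) n k)) [] →
      Polynomial._≈ₚ_ (fieldRing 𝔽) N F []
    hitting F∘𝒢≈0 = nearPoints⇒zero m (near vanishes N ℕ.≤-refl)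
      where
      k = 1 + 4 * l
      vanishes : VanishesOnPoints k
      vanishes B ι y z = begin
        eval ι (point B y z) F                      ≈⟨ eval-congʳ ι (eval-𝒢 K n k ι y z) F ⟨
        eval ι (eval ι ρ ∘ SSV.𝒢 (fieldRing 𝔽) n k) F ≈⟨ eval-compose ι F (SSV.𝒢 (fieldRing 𝔽) n k) ρ ⟨
        eval ι ρ (compose (fieldRing 𝔽) F (SSV.𝒢 (fieldRing 𝔽) n k)) ≈⟨ Linear.lin-zero ι (compose (fieldRing 𝔽) F (SSV.𝒢 (fieldRing 𝔽) n k)) _ F∘𝒢≈0 ⟩
        0#                                          ∎
        where
        open Ring B
        open ≈-Reasoning
        open Generator (lookup ∘ subsetAt n)
        ρ = y ++ᶠ (uncurry z ∘ remQuot n)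

compose-zero : (K : CommutativeRing c ℓ) → ∀ {m m′} (F : Poly (CommutativeRing.rawRing K) m) g →
  Polynomial._≈ₚ_ (CommutativeRing.rawRing K) m F [] → Polynomial._≈ₚ_ (CommutativeRing.rawRing K) m′ (compose (CommutativeRing.rawRing K) F g) []
compose-zero K {m} {m′} F g F≈0 e = trans
  (reflexive (≡.cong (λ p → Coeff.coeff K p e) (compose≡eval {A = K} F g)))
  (PolyRing.coeff≈ (Linear.lin-zero (conHom K m′) F (monomial {B = K [X m′ ]} g) F≈0) e)
  where open Ring K

theorem5p19 : ∀ {c ℓ₁ ℓ₂} (n w d : ℕ) .{{_ : NonZero n}} .{{_ : NonZero w}} .{{_ : NonZero d}} →
    (𝔽 : HeytingField c ℓ₁ ℓ₂) → Cardinality> 𝔽 (n * d) →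
    let R = fieldRing 𝔽
        N = 2 ^ n
        k = 1 + 4 * ⌈log₂ w ⌉
    in
    (F : Poly R N) →
    Polynomial.IndividualDegree≤ R N d F →
    ComputedByCommutativeROABP R w F →
    Polynomial.Nonzero R N F
      ⇔ Polynomial.Nonzero R (SSV.#yz R n k) (compose R F (SSV.𝒢 R n k))
theorem5p19 n w d 𝔽 _ F _ computed = mk⇔
  (λ F≉0 F∘𝒢≈0 → F≉0 (hitting 𝔽 w n F computed F∘𝒢≈0))
  (λ F∘𝒢≉0 F≈0 → F∘𝒢≉0 (compose-zero (fieldCommutativeRing 𝔽) F _ F≈0))
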